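{- For every integer $k \geq 3$, there exist $k$-graphs $F_1$ and $F_2$ such that \[ 0 < \gamma^+(F_1, F_2) < \min\{\gamma^+(F_1), \gamma^+(F_2)\}. \]
   Context: For an integer $k\ge 2$, a $k$-graph ($k$-uniform hypergraph) $H$ consists of a (finite) vertex set $V(H)$ and an edge set $E(H)\subseteq\binom{V(H)}{k}$. For a family $\mathcal{F}$ of $k$-graphs, a $k$-graph is $\mathcal{F}$-free if it contains no member of $\mathcal{F}$ as a (not necessarily induced) subgraph. For a $k$-graph $H$ with $E(H)\neq\emptyset$, the minimum positive codegree $\delta^+_{k-1}(H)$ is the minimum, over all $(k-1)$-subsets $S$ of $V(H)$ that are contained in at least one edge of $H$, of the number of edges of $H$ containing $S$; if $E(H)=\emptyset$ then $\delta^+_{k-1}(H):=0$. For a family $\mathcal{F}$ of $k$-graphs, $\mathrm{ex}^+_{k-1}(n,\mathcal{F})$ is the maximum of $\delta^+_{k-1}(H)$ over all $n$-vertex $\mathcal{F}$-free $k$-graphs $H$, and the positive codegree density is $\gamma^+(\mathcal{F}):=\lim_{n\to\infty}\mathrm{ex}^+_{k-1}(n,\mathcal{F})/n$ (the limit is known to exist). Abbreviate $\gamma^+(F):=\gamma^+(\{F\})$ and $\gamma^+(F,H):=\gamma^+(\{F,H\})$. -}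

module Defs where

open import Data.Bool.Base using (Bool; true; false; T; _∧_)
open import Data.Bool.Properties using (T?; T-∧)
open import Data.Fin.Base using (Fin; finToFun; funToFin)
open import Data.Fin.Properties using (any?; all?; finToFun-funToFin) renaming (_≟_ to _≟ᶠ_)
open import Data.Fin.Subset using (Subset; _∈_; _⊆_; ∣_∣; inside; outside)
open import Data.Fin.Subset.Properties using (_∈?_; _⊆?_)
open import Data.Integer.Base using (+_)
open import Data.List.Base using (List; []; _∷_; _++_; map; filter; length)
open import Data.List.Extrema.Nat using (min; max; xs≤max; argmax-sel)
open import Data.List.Membership.Propositional using () renaming (_∈_ to _∈ˡ_)
open import Data.List.Membership.Propositional.Properties
  using (∈-map⁺; ∈-map⁻; ∈-++⁺ˡ; ∈-++⁺ʳ; ∈-filter⁺; ∈-filter⁻)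
import Data.List.Membership.DecPropositional as DecMembership
open import Data.List.Properties using (filter-≐)
open import Data.List.Relation.Unary.All as All using (All)
open import Data.List.Relation.Unary.Any as Any using (Any; here; there)
open import Data.Nat.Base using (ℕ; zero; suc; _∸_; _≤_; _≥_; _≡ᵇ_; _⊔_)
open import Data.Nat.Properties using (_≟_; ≡ᵇ⇒≡; ≡⇒≡ᵇ; n≤0⇒n≡0; m≤m⊔n; m≤n⊔m)
open import Data.Product.Base using (∃; _×_; _,_; proj₁; proj₂)
open import Data.Rational.Unnormalised.Base as ℚᵘ using (ℚᵘ; 0ℚᵘ; _/_)
import Data.Rational.Unnormalised.Properties as ℚᵘ
open import Data.Sum.Base using (_⊎_; inj₁; inj₂)
open import Data.Vec.Base using ([]; _∷_; tabulate)
open import Data.Vec.Properties using (tabulate-cong; ≡-dec)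
import Data.Bool.Properties as Bool
open import Function.Base using (_∘_; id)
open import Function.Bundles using (Equivalence; _⇔_; mk⇔)
open import Function.Definitions using (Injective)
open import Relation.Binary.PropositionalEquality
open import Relation.Nullary.Decidable using (Dec; yes; no; does; ¬?; _×-dec_; _→-dec_; map′; dec-true; does-⇔)
open import Relation.Nullary.Negation using (¬_; contradiction)

record Hypergraph (k n : ℕ) : Set where
  field
    edge    : Subset n → Bool
    uniform : ∀ {e} → T (edge e) → ∣ e ∣ ≡ k

open Hypergraph public

-- Each subset is listed exactly once, so lengths of filtered sublists are
-- cardinalities.
subsets : ∀ n → List (Subset n)
subsets zero    = [] ∷ []
subsets (suc n) = map (inside ∷_) (subsets n) ++ map (outside ∷_) (subsets n)

module _ {k n : ℕ} (H : Hypergraph k n) where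

  edges : List (Subset n)
  edges = filter (T? ∘ edge H) (subsets n)

  codegree : Subset n → ℕ
  codegree S = length (filter (S ⊆?_) edges)

  shadow : List (Subset n)
  shadow = filter (λ S → (∣ S ∣ ≟ k ∸ 1) ×-dec Any.any? (S ⊆?_) edges) (subsets n)

minimum : List ℕ → ℕ
minimum []       = 0
minimum (x ∷ xs) = min x xs

-- For k ≥ 1 the shadow is empty exactly when there are no edges.
δ⁺ : ∀ {k n} → Hypergraph k n → ℕ
δ⁺ H = minimum (map (codegree H) (shadow H))

hit? : ∀ {m n} (φ : Fin m → Fin n) S j → Dec (∃ λ i → i ∈ S × φ i ≡ j)
hit? φ S j = any? λ i → (i ∈? S) ×-dec (φ i ≟ᶠ j)

image : ∀ {m n} → (Fin m → Fin n) → Subset m → Subset n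
image φ S = tabulate λ j → does (hit? φ S j)

IsEmbedding : ∀ {k m n} → Hypergraph k m → Hypergraph k n → (Fin m → Fin n) → Set
IsEmbedding F H φ = Injective _≡_ _≡_ φ × All (λ e → T (edge H (image φ e))) (edges F)

Contains : ∀ {k m n} → Hypergraph k n → Hypergraph k m → Set
Contains H F = ∃ (IsEmbedding F H)

Graph : ℕ → Set
Graph k = ∃ (Hypergraph k)

Family : ℕ → Set
Family k = List (Graph k)

Free : ∀ {k n} → Family k → Hypergraph k n → Set
Free 𝓕 H = All (λ (_ , F) → ¬ Contains H F) 𝓕

image-cong : ∀ {m n} {φ ψ : Fin m → Fin n} → φ ≗ ψ → image φ ≗ image ψ
image-cong {φ = φ} {ψ} φ≗ψ S = tabulate-cong λ j → does-⇔
  (mk⇔ (λ (i , i∈S , eq) → i , i∈S , trans (sym (φ≗ψ i)) eq)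
       (λ (i , i∈S , eq) → i , i∈S , trans (φ≗ψ i) eq))
  (hit? φ S j) (hit? ψ S j)

injective? : ∀ {m n} (φ : Fin m → Fin n) → Dec (Injective _≡_ _≡_ φ)
injective? φ = map′ (λ inj {i} {j} → inj i j) (λ inj i j → inj)
  (all? λ i → all? λ j → (φ i ≟ᶠ φ j) →-dec (i ≟ᶠ j))

contains? : ∀ {k m n} (H : Hypergraph k n) (F : Hypergraph k m) → Dec (Contains H F)
contains? {m = m} {n} H F = map′
  (λ (c , emb) → finToFun c , emb)
  (λ (φ , inj , emb) → funToFin φ ,
    (λ {i} {j} eq → inj (trans (sym (finToFun-funToFin φ i)) (trans eq (finToFun-funToFin φ j)))) ,
    All.map (λ {e} → subst (T ∘ edge H) (sym (image-cong (finToFun-funToFin φ) e))) emb)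
  (any? λ c → injective? (finToFun {n} {m} c) ×-dec All.all? (λ _ → T? _) (edges F))

free? : ∀ {k n} (𝓕 : Family k) (H : Hypergraph k n) → Dec (Free 𝓕 H)
free? 𝓕 H = All.all? (λ (_ , F) → ¬? (contains? H F)) 𝓕

sublists : ∀ {A : Set} → List A → List (List A)
sublists []       = [] ∷ []
sublists (x ∷ xs) = map (x ∷_) (sublists xs) ++ sublists xs

module _ {n : ℕ} where
  open DecMembership (≡-dec {n = n} Bool._≟_) public using () renaming (_∈?_ to _∈ˡ?_)

fromList : ∀ k {n} → List (Subset n) → Hypergraph k n
fromList k es .edge e = does (e ∈ˡ? es) ∧ (∣ e ∣ ≡ᵇ k)
fromList k es .uniform {e} t = ≡ᵇ⇒≡ ∣ e ∣ k (proj₂ (Equivalence.to T-∧ t))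

hypergraphs : ∀ k n → List (Hypergraph k n)
hypergraphs k n = map (fromList k) (sublists (subsets n))

-- The maximum is 0 when there is no 𝓕-free k-graph on n vertices; the two
-- lemmas below show that it is the intended maximum otherwise.
ex⁺ : ∀ {k} → Family k → ℕ → ℕ
ex⁺ {k} 𝓕 n = max 0 (map δ⁺ (filter (free? 𝓕) (hypergraphs k n)))

∈-subsets : ∀ {n} (S : Subset n) → S ∈ˡ subsets n
∈-subsets []            = here refl
∈-subsets (inside  ∷ S) = ∈-++⁺ˡ (∈-map⁺ _ (∈-subsets S))
∈-subsets (outside ∷ S) = ∈-++⁺ʳ (map (inside ∷_) (subsets _)) (∈-map⁺ _ (∈-subsets S))

private
  filter∈sublists : ∀ {A : Set} {P : A → Set} (P? : ∀ x → Dec (P x)) xs →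
                    filter P? xs ∈ˡ sublists xs
  filter∈sublists P? [] = here refl
  filter∈sublists P? (x ∷ xs) with does (P? x)
  ... | true  = ∈-++⁺ˡ (∈-map⁺ (x ∷_) (filter∈sublists P? xs))
  ... | false = ∈-++⁺ʳ (map (x ∷_) (sublists xs)) (filter∈sublists P? xs)

  module _ {k n} (H : Hypergraph k n) where

    H′ : Hypergraph k n
    H′ = fromList k (edges H)

    to : ∀ {e} → T (edge H e) → T (edge H′ e)
    to {e} t = Equivalence.from T-∧
      ( subst T (sym (dec-true (e ∈ˡ? edges H) (∈-filter⁺ (T? ∘ edge H) (∈-subsets e) t))) _
      , ≡⇒≡ᵇ ∣ e ∣ k (uniform H t))

    from : ∀ {e} → T (edge H′ e) → T (edge H e)
    from {e} t with e ∈ˡ? edges H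
    ... | yes e∈ = proj₂ (∈-filter⁻ (T? ∘ edge H) {xs = subsets n} e∈)

    δ⁺-H′ : δ⁺ H′ ≡ δ⁺ H
    δ⁺-H′ = cong
      (λ E → minimum (map (λ S → length (filter (S ⊆?_) E))
        (filter (λ S → (∣ S ∣ ≟ k ∸ 1) ×-dec Any.any? (S ⊆?_) E) (subsets n))))
      (filter-≐ (T? ∘ edge H′) (T? ∘ edge H) (from , to) (subsets n))

    Free-H′ : ∀ {𝓕} → Free 𝓕 H → Free 𝓕 H′
    Free-H′ = All.map λ H⊉F (φ , inj , emb) → H⊉F (φ , inj , All.map from emb)

    H′∈hypergraphs : H′ ∈ˡ hypergraphs k n
    H′∈hypergraphs = ∈-map⁺ (fromList k) (filter∈sublists (T? ∘ edge H) (subsets n))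

δ⁺≤ex⁺ : ∀ {k n} (𝓕 : Family k) (H : Hypergraph k n) → Free 𝓕 H → δ⁺ H ≤ ex⁺ 𝓕 n
δ⁺≤ex⁺ {k} {n} 𝓕 H free = subst (_≤ ex⁺ 𝓕 n) (δ⁺-H′ H)
  (All.lookup (xs≤max 0 (map δ⁺ (filter (free? 𝓕) (hypergraphs k n))))
    (∈-map⁺ δ⁺ (∈-filter⁺ (free? 𝓕) (H′∈hypergraphs H) (Free-H′ H free))))

ex⁺-attained : ∀ {k n} (𝓕 : Family k) (H : Hypergraph k n) → Free 𝓕 H →
               ∃ λ (G : Hypergraph k n) → Free 𝓕 G × δ⁺ G ≡ ex⁺ 𝓕 n
ex⁺-attained {k} {n} 𝓕 H free
  with argmax-sel id 0 (map δ⁺ (filter (free? 𝓕) (hypergraphs k n)))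
... | inj₁ ex≡0 = H , free , trans (n≤0⇒n≡0 (subst (δ⁺ H ≤_) ex≡0 (δ⁺≤ex⁺ 𝓕 H free))) (sym ex≡0)
... | inj₂ ex∈
  with G , G∈ , ex≡ ← ∈-map⁻ δ⁺ ex∈
  = G , proj₂ (∈-filter⁻ (free? 𝓕) {xs = hypergraphs k n} G∈) , sym ex≡

-- Lower x q means q < x, Upper x q means x < q.
record Cut : Set₁ where
  field
    Lower Upper : ℚᵘ → Set

open Cut public

fromℚᵘ : ℚᵘ → Cut
fromℚᵘ p .Lower q = q ℚᵘ.< p
fromℚᵘ p .Upper q = p ℚᵘ.< q

infix  4 _<ᶜ_
infixl 7 _⊓ᶜ_

_<ᶜ_ : Cut → Cut → Set
x <ᶜ y = ∃ λ q → Upper x q × Lower y q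

_⊓ᶜ_ : Cut → Cut → Cut
(x ⊓ᶜ y) .Lower q = Lower x q × Lower y q
(x ⊓ᶜ y) .Upper q = Upper x q ⊎ Upper y q

Eventually : (ℕ → Set) → Set
Eventually P = ∃ λ N → ∀ n → n ≥ N → P n

-- The strict inequality with r is needed: a n can exceed q for all n while
-- converging to q.
lim : (ℕ → ℚᵘ) → Cut
lim a .Lower q = ∃ λ r → q ℚᵘ.< r × Eventually λ n → r ℚᵘ.≤ a n
lim a .Upper q = ∃ λ r → r ℚᵘ.< q × Eventually λ n → a n ℚᵘ.≤ r

record IsReal (x : Cut) : Set where
  field
    lower-inhabited : ∃ (Lower x)
    upper-inhabited : ∃ (Upper x)
    lower-down      : ∀ {p q} → p ℚᵘ.< q → Lower x q → Lower x p
    upper-up        : ∀ {p q} → p ℚᵘ.< q → Upper x p → Upper x q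
    lower-open      : ∀ {p} → Lower x p → ∃ λ q → p ℚᵘ.< q × Lower x q
    upper-open      : ∀ {q} → Upper x q → ∃ λ p → p ℚᵘ.< q × Upper x p
    disjoint        : ∀ {q} → ¬ (Lower x q × Upper x q)
    located         : ∀ {p q} → p ℚᵘ.< q → Lower x p ⊎ Upper x q

_⟶_ : (ℕ → ℚᵘ) → Cut → Set
a ⟶ x = (∀ {p} → Lower x p → Eventually λ n → p ℚᵘ.< a n)
      × (∀ {q} → Upper x q → Eventually λ n → a n ℚᵘ.< q)

private
  clash : ∀ {P Q : ℕ → Set} → (∀ {n} → P n → ¬ Q n) → Eventually P → ¬ Eventually Q
  clash ¬PQ (M , p) (N , q) = ¬PQ (p (M ⊔ N) (m≤m⊔n M N)) (q (M ⊔ N) (m≤n⊔m M N))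

-- Whenever a converges to a real number, that number is lim a; so lim is only
-- a genuine generalisation on divergent sequences, where its lower and upper
-- cuts are those of the limit inferior and the limit superior.
lim-correct : ∀ {a x} → IsReal x → a ⟶ x →
              (∀ {q} → Lower (lim a) q ⇔ Lower x q) × (∀ {q} → Upper (lim a) q ⇔ Upper x q)
lim-correct {a} {x} real (below , above) = mk⇔ lower⇒ lower⇐ , mk⇔ upper⇒ upper⇐
  where
  open IsReal real

  lower⇒ : ∀ {q} → Lower (lim a) q → Lower x q
  lower⇒ (r , q<r , r≤a) with located q<r
  ... | inj₁ q<x = q<x
  ... | inj₂ x<r = contradiction (above x<r) (clash (λ r≤an an<r → ℚᵘ.<⇒≱ an<r r≤an) r≤a)

  lower⇐ : ∀ {q} → Lower x q → Lower (lim a) q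
  lower⇐ q<x with r , q<r , r<x ← lower-open q<x
    with N , r<a ← below r<x
    = r , q<r , N , λ n n≥N → ℚᵘ.<⇒≤ (r<a n n≥N)

  upper⇒ : ∀ {q} → Upper (lim a) q → Upper x q
  upper⇒ (r , r<q , a≤r) with located r<q
  ... | inj₁ r<x = contradiction (below r<x) (clash (λ an≤r r<an → ℚᵘ.<⇒≱ r<an an≤r) a≤r)
  ... | inj₂ x<q = x<q

  upper⇐ : ∀ {q} → Upper x q → Upper (lim a) q
  upper⇐ x<q with r , r<q , x<r ← upper-open x<q
    with N , a<r ← above x<r
    = r , r<q , N , λ n n≥N → ℚᵘ.<⇒≤ (a<r n n≥N)

-- The value at 0 is irrelevant for the limit.
ratio : ∀ {k} → Family k → ℕ → ℚᵘ
ratio 𝓕 zero        = 0ℚᵘ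
ratio 𝓕 n@(suc _) = + ex⁺ 𝓕 n / n

γ⁺ : ∀ {k} → Family k → Cut
γ⁺ 𝓕 = lim (ratio 𝓕)

{-# OPTIONS --safe #-}
module Submission where

-- For F₁ take a (k-2)-set S together with all edges S ∪ {p, q}, where p, q
-- range over four further vertices.  For F₂ take a central edge e, three
-- vertices of which are rooted: each of them, x say, can replace either of two
-- vertices of a satellite edge of its own.
--
-- Lower bounds: colour the vertices with classes of equal size and take the
-- k-sets meeting each class in at most a prescribed number of vertices.
--   * k+1 classes, at most 1 vertex each: F₁-free, because any two of the k+2
--     vertices of F₁ share an edge.  Density 2/(k+1) ≥ 1/(k-1).
--   * k-1 classes, 2 vertices of the first class and 1 of each other one:
--     F₂-free, because a rooted vertex and the two vertices that it replaces
--     must have the same colour, so that e would have three vertices in the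
--     first class.  Density 1/(k-1).
--   * k classes, 1 vertex each: free of both.  Density 1/k > 0.
--
-- Upper bound: let D be the minimum positive codegree of an {F₁,F₂}-free H,
-- and call a vertex robust if it stays rooted after the removal of any 3k
-- vertices.  Being F₂-free, H has no edge with three robust vertices.  If
-- D > n/k, then every edge e of a suitably generic kind has two vertices that
-- can be replaced by one and the same new vertex, and both are robust; write
-- e = S ∪ {x, y} with x, y robust.  The k-2 sets of vertices that can replace
-- the different vertices of S are essentially disjoint and contain no robust
-- vertex, while all vertices that can replace x or y are essentially robust.
-- So the link of S lives on n - (k-2)D vertices and has minimum degree D; for
-- D > 2n/(2k-1) it contains a K₄, which is a copy of F₁.  Hence the density of
-- {F₁,F₂} is at most 2/(2k-1) < 1/(k-1); with K = k-1, the proof below settles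
-- for the bound 4/(4K+1), which still is less than 1/K.

open import Defs
open import Data.Bool.Base using (Bool; true; false; T; _∧_; _∨_; not)
open import Data.Bool.Properties using (T?; T-∧)
open import Data.Empty using (⊥)
open import Data.Fin.Base as Fin using
  (Fin; zero; suc; punchIn; punchOut; combine; remQuot; splitAt;
  toℕ; fromℕ<; inject≤)
open import Data.Fin.Permutation using (Permutation′; _⟨$⟩ʳ_; _⟨$⟩ˡ_; _∘ₚ_; transpose; inverseʳ; inverseˡ)
  renaming (id to idₚ)
open import Data.Fin.Properties
  using (_≟_; any?; all?; suc-injective; <-cmp; pigeonhole; punchInᵢ≢i; punchIn-injective; punchIn-punchOut;
         remQuot-combine; combine-remQuot; combine-injectiveˡ; combine-injectiveʳ;
         toℕ<n; toℕ-fromℕ<; toℕ-inject≤; toℕ-injective)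
open import Data.Fin.Subset using (Subset; _∈_; _⊆_; ∣_∣; ⊤; inside; outside)
open import Data.Fin.Subset.Properties using (∈⊤; ⊆-antisym; _⊆?_; _∈?_; p⊆q⇒∣p∣≤∣q∣; drop-∷-⊆)
import Data.Integer.Base as ℤ
import Data.Integer.Properties as ℤ
open import Data.List.Base as List using (List; []; _∷_; _++_; map; filter; length; allFin; tabulate)
open import Data.List.Extrema.Nat using (min≤⊤; min≤xs; v≤min⁺)
open import Data.List.Membership.Propositional using (find; lose) renaming (_∈_ to _∈ˡ_)
open import Data.List.Membership.Propositional.Properties
  using (∈-map⁺; ∈-map⁻; ∈-filter⁺; ∈-filter⁻; ∈-allFin; ∈-∃++; ∈-++⁺ˡ; ∈-++⁺ʳ; ∈-++⁻)
open import Data.List.Properties using (length-++)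
open import Data.List.Relation.Unary.All as All using (All; []; _∷_)
import Data.List.Relation.Unary.All.Properties as All
open import Data.List.Relation.Unary.AllPairs using ([]; _∷_)
open import Data.List.Relation.Unary.Any as Any using (here; there)
open import Data.List.Relation.Unary.Unique.Propositional using (Unique)
import Data.List.Relation.Unary.Unique.Propositional.Properties as Unique
open import Data.Nat.Base using
  (ℕ; zero; suc; _+_; _*_; _∸_; _⊔_; _/_; _≤_; _<_; _≥_; _≡ᵇ_; z≤n; s≤s; z<s; >-nonZero)
open import Data.Nat.DivMod using (m≡m%n+[m/n]*n; m%n<n; m/n*n≤m)
open import Data.Nat.Properties hiding (_≟_; suc-injective; <-cmp)
import Data.Nat.Properties as ℕ
open import Data.Nat.Tactic.RingSolver using (solve-∀)
open import Data.Product.Base using (∃; _×_; _,_; proj₁; proj₂; uncurry)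
open import Data.Rational.Unnormalised.Base as ℚᵘ using (ℚᵘ; 0ℚᵘ; *≤*; *<*)
open import Data.Sum.Base using (_⊎_; inj₁; inj₂)
open import Data.Sum.Properties using ([,]-map)
open import Data.Unit.Base using () renaming (⊤ to Unit)
open import Data.Vec.Base as Vec using (lookup)
open import Data.Vec.Functional using (updateAt; removeAt; tail) renaming (_∷_ to _◂_; _++_ to _++ᶠ_)
open import Data.Vec.Functional.Properties using (updateAt-updates; updateAt-minimal)
open import Data.Vec.Properties using (lookup∘tabulate; []=⇒lookup; lookup⇒[]=; ∷-injectiveʳ)
open import Function.Base using (_∘_; id; const)
open import Function.Bundles using (Equivalence)
open import Function.Definitions using (Injective)
open import Relation.Binary.Definitions using (tri<; tri≈; tri>)
open import Relation.Binary.PropositionalEquality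
open import Relation.Nullary.Decidable using (Dec; yes; no; does; dec-true; dec-false; ¬?; _×-dec_)
open import Relation.Nullary.Negation using (¬_; contradiction)
open import Algebra.Properties.Semiring.Sum +-*-semiring
  using (sum; sum-syntax; sum-cong-≗; ∑-distrib-+; ∑-comm; *-distribˡ-sum; *-distribʳ-sum)

-- Sums over Fin n and images of tuples

Inj : ∀ {m n} → (Fin m → Fin n) → Set
Inj f = Injective _≡_ _≡_ f

𝟙 : Bool → ℕ
𝟙 true  = 1
𝟙 false = 0

⟦_≡_⟧ : ∀ {n} → Fin n → Fin n → ℕ
⟦ x ≡ v ⟧ = 𝟙 (does (x ≟ v))

𝟙-true : ∀ {b} → 0 < 𝟙 b → T b
𝟙-true {true} _ = _

does-T : ∀ {P : Set} (P? : Dec P) → T (does P?) → P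
does-T (yes p) _ = p

𝟙≤1 : ∀ b → 𝟙 b ≤ 1
𝟙≤1 true  = ≤-refl
𝟙≤1 false = z≤n

T⇒𝟙≡1 : ∀ {b} → T b → 𝟙 b ≡ 1
T⇒𝟙≡1 {true} _ = refl

⟦≡⟧-yes : ∀ {n} {x v : Fin n} → x ≡ v → ⟦ x ≡ v ⟧ ≡ 1
⟦≡⟧-yes {x = x} {v} eq = cong 𝟙 (dec-true (x ≟ v) eq)

⟦≡⟧-no : ∀ {n} {x v : Fin n} → x ≢ v → ⟦ x ≡ v ⟧ ≡ 0
⟦≡⟧-no {x = x} {v} neq = cong 𝟙 (dec-false (x ≟ v) neq)

∑-mono : ∀ {n} {f g : Fin n → ℕ} → (∀ i → f i ≤ g i) → sum f ≤ sum g
∑-mono {zero}  f≤g = z≤n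
∑-mono {suc n} f≤g = +-mono-≤ (f≤g zero) (∑-mono (f≤g ∘ suc))

∑-mono-< : ∀ {n} {f g : Fin n → ℕ} → (∀ i → f i ≤ g i) → ∀ i → f i < g i → sum f < sum g
∑-mono-< f≤g zero    fi<gi = +-mono-<-≤ fi<gi (∑-mono (f≤g ∘ suc))
∑-mono-< f≤g (suc i) fi<gi = +-mono-≤-< (f≤g zero) (∑-mono-< (f≤g ∘ suc) i fi<gi)

∑-squeeze : ∀ {n} {f g : Fin n → ℕ} → (∀ i → f i ≤ g i) → sum g ≤ sum f → ∀ i → f i ≡ g i
∑-squeeze {f = f} {g} f≤g Σg≤Σf i = ≤-antisym (f≤g i) (≮⇒≥ λ fi<gi → <⇒≱ (∑-mono-< f≤g i fi<gi) Σg≤Σf)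

∑-const : ∀ n c → ∑[ i < n ] c ≡ n * c
∑-const zero    c = refl
∑-const (suc n) c = cong (c +_) (∑-const n c)

∑-zero : ∀ n → ∑[ i < n ] 0 ≡ 0
∑-zero n = trans (∑-const n 0) (*-zeroʳ n)

∑-bound : ∀ {n} {f : Fin n → ℕ} {c} → (∀ i → f i ≤ c) → sum f ≤ n * c
∑-bound {n} {c = c} f≤c = ≤-trans (∑-mono f≤c) (≤-reflexive (∑-const n c))

≤-∑ : ∀ {n} (f : Fin n → ℕ) i → f i ≤ sum f
≤-∑ f zero    = m≤m+n _ _
≤-∑ f (suc i) = ≤-trans (≤-∑ (f ∘ suc) i) (m≤n+m _ _)

∑<∑⇒∃< : ∀ {n} (f g : Fin n → ℕ) → sum f < sum g → ∃ λ i → f i < g i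
∑<∑⇒∃< {suc n} f g Σf<Σg with f zero <? g zero
... | yes f₀<g₀ = zero , f₀<g₀
... | no  f₀≮g₀ with i , fi<gi ← ∑<∑⇒∃< (f ∘ suc) (g ∘ suc)
                    (≰⇒> λ Σg≤Σf → <⇒≱ Σf<Σg (+-mono-≤ (≮⇒≥ f₀≮g₀) Σg≤Σf))
  = suc i , fi<gi

∑-select : ∀ {n} x (w : Fin n → ℕ) → ∑[ v < n ] (⟦ x ≡ v ⟧ * w v) ≡ w x
∑-select {suc n} zero w = trans (cong₂ _+_ (+-identityʳ (w zero)) (∑-zero n)) (+-identityʳ (w zero))
∑-select {suc n} (suc x) w = ∑-select x (w ∘ suc)

∑-⟦≡⟧ : ∀ {n} (x : Fin n) → ∑[ v < n ] ⟦ x ≡ v ⟧ ≡ 1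
∑-⟦≡⟧ {n} x = trans (sum-cong-≗ {n} λ v → sym (*-identityʳ ⟦ x ≡ v ⟧)) (∑-select x (const 1))

∑>1⇒distinct : ∀ {n} (p : Fin n → Bool) → 1 < ∑[ i < n ] 𝟙 (p i) →
               ∃ λ i → ∃ λ j → i ≢ j × T (p i) × T (p j)
∑>1⇒distinct {n} p 1<Σ
  with i , 0<pi ← ∑<∑⇒∃< (const 0) (𝟙 ∘ p)
         (subst (_< sum (𝟙 ∘ p)) (sym (∑-zero n)) (<-trans z<s 1<Σ))
  with j , lt ← ∑<∑⇒∃< (λ j → ⟦ i ≡ j ⟧) (𝟙 ∘ p) (subst (_< sum (𝟙 ∘ p)) (sym (∑-⟦≡⟧ i)) 1<Σ)
  = i , j , (λ i≡j → <⇒≱ (subst (_< 𝟙 (p j)) (⟦≡⟧-yes i≡j) lt) (𝟙≤1 (p j)))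
  , 𝟙-true 0<pi , 𝟙-true (≤-<-trans z≤n lt)

∣∣≡∑ : ∀ {n} (S : Subset n) → ∣ S ∣ ≡ ∑[ v < n ] 𝟙 (lookup S v)
∣∣≡∑ Vec.[]          = refl
∣∣≡∑ (inside  Vec.∷ S) = cong suc (∣∣≡∑ S)
∣∣≡∑ (outside Vec.∷ S) = ∣∣≡∑ S

module _ {m n} (φ : Fin m → Fin n) {S : Subset m} where

  ∈-image⁺ : ∀ {v} → (∃ λ i → i ∈ S × φ i ≡ v) → v ∈ image φ S
  ∈-image⁺ {v} hit = lookup⇒[]= v _ (trans (lookup∘tabulate _ v) (dec-true (hit? φ S v) hit))

  ∈-image⁻ : ∀ {v} → v ∈ image φ S → ∃ λ i → i ∈ S × φ i ≡ v
  ∈-image⁻ {v} v∈ with eq ← trans (sym (lookup∘tabulate _ v)) ([]=⇒lookup v∈) | hit? φ S v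
  ... | yes hit = hit

-- Kept opaque: unfolded, tests of membership for tuples of known length
-- unroll into searches that make conversion checking explode.
opaque
  set : ∀ {m n} → (Fin m → Fin n) → Subset n
  set f = image f ⊤

  ∈-set⁺ : ∀ {m n} (f : Fin m → Fin n) i → f i ∈ set f
  ∈-set⁺ f i = ∈-image⁺ f (i , ∈⊤ , refl)

  ∈-set⁻ : ∀ {m n} (f : Fin m → Fin n) {v} → v ∈ set f → ∃ λ i → f i ≡ v
  ∈-set⁻ f v∈ with i , _ , eq ← ∈-image⁻ f v∈ = i , eq

  set-cong : ∀ {m n} {f g : Fin m → Fin n} → f ≗ g → set f ≡ set g
  set-cong f≗g = image-cong f≗g ⊤

set-⊆ : ∀ {l m n} {f : Fin l → Fin n} {g : Fin m → Fin n} →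
        (∀ i → ∃ λ j → g j ≡ f i) → set f ⊆ set g
set-⊆ {f = f} {g} h v∈ with i , refl ← ∈-set⁻ f v∈ with j , eq ← h i = subst (_∈ set g) eq (∈-set⁺ g j)

image-set : ∀ {l m n} (φ : Fin m → Fin n) (f : Fin l → Fin m) → image φ (set f) ≡ set (φ ∘ f)
image-set φ f = ⊆-antisym to from
  where
  to : image φ (set f) ⊆ set (φ ∘ f)
  to v∈ with _ , i∈ , refl ← ∈-image⁻ φ v∈ with j , refl ← ∈-set⁻ f i∈ = ∈-set⁺ (φ ∘ f) j
  from : set (φ ∘ f) ⊆ image φ (set f)
  from v∈ with j , refl ← ∈-set⁻ (φ ∘ f) v∈ = ∈-image⁺ φ (f j , ∈-set⁺ f j , refl)

module _ {m n} (f : Fin m → Fin n) where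

  fibre : Fin n → ℕ
  fibre v = ∑[ i < m ] ⟦ f i ≡ v ⟧

  ∑-fibre : (w : Fin n → ℕ) → ∑[ v < n ] (fibre v * w v) ≡ ∑[ i < m ] w (f i)
  ∑-fibre w = begin
    ∑[ v < n ] (fibre v * w v)                   ≡⟨ sum-cong-≗ {n} (λ v → trans (*-comm (fibre v) (w v))
                                                      (trans (*-distribˡ-sum (w v) (λ i → ⟦ f i ≡ v ⟧))
                                                        (sum-cong-≗ {m} λ i → *-comm (w v) ⟦ f i ≡ v ⟧))) ⟩
    ∑[ v < n ] ∑[ i < m ] (⟦ f i ≡ v ⟧ * w v)    ≡⟨ ∑-comm {n} {m} _ ⟩
    ∑[ i < m ] ∑[ v < n ] (⟦ f i ≡ v ⟧ * w v)    ≡⟨ sum-cong-≗ {m} (λ i → ∑-select (f i) w) ⟩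
    ∑[ i < m ] w (f i)                           ∎
    where open ≡-Reasoning

  ∑-fibre-1 : ∑[ v < n ] fibre v ≡ m
  ∑-fibre-1 = trans (sum-cong-≗ {n} λ v → sym (*-identityʳ (fibre v)))
    (trans (∑-fibre (const 1)) (trans (∑-const m 1) (*-identityʳ m)))

  lookup-set≤fibre : ∀ v → 𝟙 (lookup (set f) v) ≤ fibre v
  lookup-set≤fibre v with lookup (set f) v in eq
  ... | false = z≤n
  ... | true with i , fi≡v ← ∈-set⁻ f (lookup⇒[]= v (set f) eq)
    = ≤-trans (≤-reflexive (sym (⟦≡⟧-yes fi≡v))) (≤-∑ (λ i → ⟦ f i ≡ v ⟧) i)

  fibre≤1 : Inj f → ∀ v → fibre v ≤ 1
  fibre≤1 inj v = ≮⇒≥ λ 1<Σ → distinct (∑>1⇒distinct (λ i → does (f i ≟ v)) 1<Σ)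
    where
    distinct : ¬ (∃ λ i → ∃ λ j → i ≢ j × T (does (f i ≟ v)) × T (does (f j ≟ v)))
    distinct (i , j , i≢j , p , q) = i≢j (inj (trans (does-T (f i ≟ v) p) (sym (does-T (f j ≟ v) q))))

  lookup-set≡fibre : Inj f → ∀ v → 𝟙 (lookup (set f) v) ≡ fibre v
  lookup-set≡fibre inj v = ≤-antisym (lookup-set≤fibre v) ge
    where
    ge : fibre v ≤ 𝟙 (lookup (set f) v)
    ge with fibre v in eq
    ... | zero = z≤n
    ... | suc c with i , 0<fi ← ∑<∑⇒∃< (const 0) (λ i → ⟦ f i ≡ v ⟧)
                       (subst₂ _<_ (sym (∑-zero m)) (sym eq) z<s)
      rewrite sym (does-T (f i ≟ v) (𝟙-true 0<fi))
      | []=⇒lookup (∈-set⁺ f i) = subst (_≤ 1) (trans (cong fibre refl) eq) (fibre≤1 inj _)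

  ∑-set : Inj f → (w : Fin n → ℕ) → ∑[ v < n ] (𝟙 (lookup (set f) v) * w v) ≡ ∑[ i < m ] w (f i)
  ∑-set inj w = trans (sum-cong-≗ {n} λ v → cong (_* w v) (lookup-set≡fibre inj v)) (∑-fibre w)

  ∣set∣ : Inj f → ∣ set f ∣ ≡ m
  ∣set∣ inj = trans (∣∣≡∑ (set f)) (trans (sum-cong-≗ {n} (lookup-set≡fibre inj)) ∑-fibre-1)

  collision⇒fibre>1 : ∀ {i j} → i ≢ j → f i ≡ f j → 1 < fibre (f i)
  collision⇒fibre>1 {i} {j} i≢j fi≡fj = ≤-trans
    (≤-reflexive (sym (trans (∑-distrib-+ (λ l → ⟦ i ≡ l ⟧) (λ l → ⟦ j ≡ l ⟧)) (cong₂ _+_ (∑-⟦≡⟧ i) (∑-⟦≡⟧ j)))))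
    (∑-mono pair≤)
    where
    pair≤ : ∀ l → ⟦ i ≡ l ⟧ + ⟦ j ≡ l ⟧ ≤ ⟦ f l ≡ f i ⟧
    pair≤ l with i ≟ l | j ≟ l
    ... | yes refl | yes refl = contradiction refl i≢j
    ... | yes refl | no _     = ≤-reflexive (sym (⟦≡⟧-yes {x = f i} refl))
    ... | no _     | yes refl = ≤-reflexive (sym (⟦≡⟧-yes (sym fi≡fj)))
    ... | no _     | no _     = z≤n

  fibre≤1⇒Inj : (∀ v → fibre v ≤ 1) → Inj f
  fibre≤1⇒Inj ≤1 {i} {j} fi≡fj with i ≟ j
  ... | yes i≡j = i≡j
  ... | no  i≢j = contradiction (≤1 (f i)) (<⇒≱ (collision⇒fibre>1 i≢j fi≡fj))

  -- A collision would make one fibre larger than the indicator of the image.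
  ∣set∣⇒Inj : ∣ set f ∣ ≡ m → Inj f
  ∣set∣⇒Inj eq = fibre≤1⇒Inj λ v → ≤-trans (≤-reflexive (sym (∑-squeeze lookup-set≤fibre
    (≤-reflexive (trans ∑-fibre-1 (trans (sym eq) (∣∣≡∑ (set f))))) v))) (𝟙≤1 _)

enumerate′ : ∀ {n} (S : Subset n) →
     ∃ λ (f : Fin ∣ S ∣ → Fin n) → Inj f × (∀ i → f i ∈ S) × (∀ {v} → v ∈ S → ∃ λ i → f i ≡ v)
enumerate′ Vec.[] = (λ ()) , (λ { {()} }) , (λ ()) , λ ()
enumerate′ (outside Vec.∷ S) with f , inj , f∈ , f-onto ← enumerate′ S
  = suc ∘ f , inj ∘ suc-injective , Vec.there ∘ f∈
  , λ { (Vec.there v∈) → let i , eq = f-onto v∈ in i , cong suc eq }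
enumerate′ (inside Vec.∷ S) with f , inj , f∈ , f-onto ← enumerate′ S
  = zero ◂ (suc ∘ f)
  , (λ { {zero} {zero} _ → refl ; {suc i} {suc j} eq → cong suc (inj (suc-injective eq)) })
  , (λ { zero → Vec.here ; (suc i) → Vec.there (f∈ i) })
  , λ { Vec.here → zero , refl ; (Vec.there v∈) → let i , eq = f-onto v∈ in suc i , cong suc eq }

enumerate : ∀ {n} (S : Subset n) → ∃ λ (f : Fin ∣ S ∣ → Fin n) → Inj f × set f ≡ S
enumerate S with f , inj , f∈ , f-onto ← enumerate′ S
  = f , inj , ⊆-antisym (λ v∈ → let i , eq = ∈-set⁻ f v∈ in subst (_∈ S) eq (f∈ i))
                        (λ v∈ → let i , eq = f-onto v∈ in subst (_∈ set f) eq (∈-set⁺ f i))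

-- Hypergraphs in terms of tuples

-- Each element of `xs` uses up a related element of `ys`, which is deleted before the rest is
-- matched. A relation serves because partners are only known to exist.
length-≤ : ∀ {A B : Set} (_~_ : A → B → Set) (xs : List A) (ys : List B) → Unique xs →
           (∀ {x} → x ∈ˡ xs → ∃ λ y → y ∈ˡ ys × x ~ y) →
           (∀ {x x′ y} → x ∈ˡ xs → x′ ∈ˡ xs → x ~ y → x′ ~ y → x ≡ x′) →
           length xs ≤ length ys
length-≤ _~_ [] ys _ _ _ = z≤n
length-≤ _~_ (x ∷ xs) ys (x≢ ∷ u) total inj
  with y , y∈ , x~y ← total (here refl)
  with as , bs , refl ← ∈-∃++ y∈
  = ≤-trans (s≤s (length-≤ _~_ xs (as ++ bs) u total′ λ p q → inj (there p) (there q)))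
      (≤-reflexive (trans (cong suc (length-++ as))
        (trans (sym (+-suc (length as) (length bs))) (sym (length-++ as)))))
  where
  total′ : ∀ {x′} → x′ ∈ˡ xs → ∃ λ y′ → y′ ∈ˡ as ++ bs × x′ ~ y′
  total′ {x′} x′∈ with y′ , y′∈ , x′~y′ ← total (there x′∈) with ∈-++⁻ as y′∈
  ... | inj₁ ∈as         = y′ , ∈-++⁺ˡ ∈as , x′~y′
  ... | inj₂ (there ∈bs) = y′ , ∈-++⁺ʳ as ∈bs , x′~y′
  ... | inj₂ (here refl) =
    contradiction (inj (here refl) (there x′∈) x~y x′~y′) (All.lookup x≢ x′∈)

length-filter-tabulate : ∀ {A : Set} {n} (p : A → Bool) (f : Fin n → A) →
                         length (filter (T? ∘ p) (List.tabulate f)) ≡ ∑[ i < n ] 𝟙 (p (f i))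
length-filter-tabulate {n = zero}  p f = refl
length-filter-tabulate {n = suc n} p f with p (f zero)
... | true  = cong suc (length-filter-tabulate p (f ∘ suc))
... | false = length-filter-tabulate p (f ∘ suc)

subsets-unique : ∀ n → Unique (subsets n)
subsets-unique zero    = [] ∷ []
subsets-unique (suc n) = Unique.++⁺
  (Unique.map⁺ ∷-injectiveʳ (subsets-unique n))
  (Unique.map⁺ ∷-injectiveʳ (subsets-unique n))
  λ (p , q) → disjoint (∈-map⁻ _ p) (∈-map⁻ _ q)
  where
  disjoint : ∀ {v : Subset (suc n)} → (∃ λ S → S ∈ˡ subsets n × v ≡ inside Vec.∷ S) →
             ¬ (∃ λ S → S ∈ˡ subsets n × v ≡ outside Vec.∷ S)
  disjoint (_ , _ , refl) (_ , _ , ())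

⊆∧∣≡∣⇒≡ : ∀ {n} {p q : Subset n} → p ⊆ q → ∣ p ∣ ≡ ∣ q ∣ → p ≡ q
⊆∧∣≡∣⇒≡ {p = Vec.[]} {Vec.[]} _ _ = refl
⊆∧∣≡∣⇒≡ {p = inside  Vec.∷ p} {inside  Vec.∷ q} p⊆q eq =
  cong (inside Vec.∷_) (⊆∧∣≡∣⇒≡ (drop-∷-⊆ p⊆q) (ℕ.suc-injective eq))
⊆∧∣≡∣⇒≡ {p = inside  Vec.∷ p} {outside Vec.∷ q} p⊆q eq with () ← p⊆q Vec.here
⊆∧∣≡∣⇒≡ {p = outside Vec.∷ p} {inside  Vec.∷ q} p⊆q eq =
  contradiction (p⊆q⇒∣p∣≤∣q∣ (drop-∷-⊆ p⊆q)) (<⇒≱ (≤-reflexive (sym eq)))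
⊆∧∣≡∣⇒≡ {p = outside Vec.∷ p} {outside Vec.∷ q} p⊆q eq =
  cong (outside Vec.∷_) (⊆∧∣≡∣⇒≡ (drop-∷-⊆ p⊆q) eq)

infixl 10 _[_≔_]
_[_≔_] : ∀ {m} {A : Set} → (Fin m → A) → Fin m → A → Fin m → A
f [ i ≔ v ] = updateAt f i (const v)

module _ {m} {A : Set} (f : Fin m → A) (i : Fin m) {v : A} where

  ≔-hit : (f [ i ≔ v ]) i ≡ v
  ≔-hit = updateAt-updates i f

  ≔-miss : ∀ {j} → j ≢ i → (f [ i ≔ v ]) j ≡ f j
  ≔-miss {j} j≢i = updateAt-minimal j i f j≢i

∘-≔ : ∀ {m} {A B : Set} (φ : A → B) (f : Fin m → A) i v → φ ∘ (f [ i ≔ v ]) ≗ (φ ∘ f) [ i ≔ φ v ]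
∘-≔ φ f zero    v zero    = refl
∘-≔ φ f zero    v (suc j) = refl
∘-≔ φ f (suc i) v zero    = refl
∘-≔ φ f (suc i) v (suc j) = ∘-≔ φ (f ∘ suc) i v j

≔-cong : ∀ {m} {A : Set} {f g : Fin m → A} → f ≗ g → ∀ i {v} → f [ i ≔ v ] ≗ g [ i ≔ v ]
≔-cong f≗g zero    zero    = refl
≔-cong f≗g zero    (suc j) = f≗g (suc j)
≔-cong f≗g (suc i) zero    = f≗g zero
≔-cong f≗g (suc i) (suc j) = ≔-cong (f≗g ∘ suc) i j

set-◂-removeAt : ∀ {m n} (f : Fin (suc m) → Fin n) i d → set (d ◂ removeAt f i) ≡ set (f [ i ≔ d ])
set-◂-removeAt f i d = ⊆-antisym
  (set-⊆ {f = d ◂ removeAt f i} {f [ i ≔ d ]} λ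
    { zero    → i , ≔-hit f i
    ; (suc j) → punchIn i j , ≔-miss f i (punchInᵢ≢i i j) })
  (set-⊆ {f = f [ i ≔ d ]} {d ◂ removeAt f i} back)
  where
  back : ∀ l → ∃ λ j → (d ◂ removeAt f i) j ≡ (f [ i ≔ d ]) l
  back l with i ≟ l
  ... | yes refl = zero , sym (≔-hit f i)
  ... | no  i≢l  = suc (punchOut i≢l) ,
    trans (cong f (punchIn-punchOut i≢l)) (sym (≔-miss f i (i≢l ∘ sym)))

module _ {k n} (H : Hypergraph k n) where

  Edge : ∀ {m} → (Fin m → Fin n) → Set
  Edge f = T (edge H (set f))

  Edge⇒Inj : {f : Fin k → Fin n} → Edge f → Inj f
  Edge⇒Inj {f} Ef = ∣set∣⇒Inj f (uniform H Ef)

  Edge-cong : ∀ {m} {f g : Fin m → Fin n} → f ≗ g → Edge f → Edge g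
  Edge-cong f≗g = subst (T ∘ edge H) (set-cong f≗g)

  edges⁺ : ∀ {e} → T (edge H e) → e ∈ˡ edges H
  edges⁺ = ∈-filter⁺ (T? ∘ edge H) (∈-subsets _)

  edges⁻ : ∀ {e} → e ∈ˡ edges H → T (edge H e)
  edges⁻ e∈ = proj₂ (∈-filter⁻ (T? ∘ edge H) {xs = subsets n} e∈)

  shadow⁺ : ∀ {S e} → ∣ S ∣ ≡ k ∸ 1 → T (edge H e) → S ⊆ e → S ∈ˡ shadow H
  shadow⁺ {S} ∣S∣ Ee S⊆e = ∈-filter⁺ (λ S → (∣ S ∣ ℕ.≟ (k ∸ 1)) ×-dec Any.any? (S ⊆?_) (edges H))
    (∈-subsets S) (∣S∣ , lose (edges⁺ Ee) S⊆e)

  shadow⁻ : ∀ {S} → S ∈ˡ shadow H → ∣ S ∣ ≡ k ∸ 1 × ∃ λ e → T (edge H e) × S ⊆ e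
  shadow⁻ S∈
    with ∣S∣ , any ← proj₂ (∈-filter⁻ (λ S → (∣ S ∣ ℕ.≟ (k ∸ 1)) ×-dec Any.any? (S ⊆?_) (edges H))
                              {xs = subsets n} S∈)
    with e , e∈ , S⊆e ← find any
    = ∣S∣ , e , edges⁻ e∈ , S⊆e

  δ⁺≤codegree : ∀ {S} → S ∈ˡ shadow H → δ⁺ H ≤ codegree H S
  δ⁺≤codegree S∈ = go (shadow H) S∈
    where
    go : ∀ xs {S} → S ∈ˡ xs → minimum (map (codegree H) xs) ≤ codegree H S
    go (x ∷ xs) (here refl) = min≤⊤ (codegree H x) (map (codegree H) xs)
    go (x ∷ xs) (there S∈)  = All.lookup (min≤xs (codegree H x) (map (codegree H) xs)) (∈-map⁺ (codegree H) S∈)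

  ≤δ⁺ : ∀ {c S} → S ∈ˡ shadow H → (∀ {S} → S ∈ˡ shadow H → c ≤ codegree H S) → c ≤ δ⁺ H
  ≤δ⁺ {c} S∈ = go (shadow H) S∈
    where
    go : ∀ xs {S} → S ∈ˡ xs → (∀ {S} → S ∈ˡ xs → c ≤ codegree H S) → c ≤ minimum (map (codegree H) xs)
    go (x ∷ xs) _ c≤ = v≤min⁺ (c≤ (here refl)) (All.map⁺ (All.tabulate (c≤ ∘ there)))

  δ⁺>0⇒edge : 0 < δ⁺ H → ∃ λ e → T (edge H e)
  δ⁺>0⇒edge 0<δ with shadow H in eq
  ... | S ∷ _ with _ , e , Ee , _ ← shadow⁻ (subst (S ∈ˡ_) (sym eq) (here refl)) = e , Ee

-- Codegrees as numbers of extending vertices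

module _ {K n} (H : Hypergraph (suc K) n) where

  module _ {g : Fin K → Fin n} (inj : Inj g) where

    private
      superedges : List (Subset n)
      superedges = filter (set g ⊆?_) (edges H)

      extensions : List (Fin n)
      extensions = filter (λ d → T? (edge H (set (d ◂ g)))) (allFin n)

      tail-⊆ : ∀ d → set g ⊆ set (d ◂ g)
      tail-⊆ d = set-⊆ {f = g} {d ◂ g} λ i → suc i , refl

      fresh : ∀ {e} → ∣ set g ∣ < ∣ e ∣ → ∃ λ d → d ∈ e × ¬ (d ∈ set g)
      fresh {e} lt with any? (λ d → (d ∈? e) ×-dec ¬? (d ∈? set g))
      ... | yes found = found
      ... | no  none  = contradiction (p⊆q⇒∣p∣≤∣q∣ e⊆) (<⇒≱ lt)
        where
        e⊆ : e ⊆ set g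
        e⊆ {d} d∈e with d ∈? set g
        ... | yes d∈g = d∈g
        ... | no  d∉g = contradiction (d , d∈e , d∉g) none

      e≡ : ∀ {e d} → d ∈ e → ¬ (d ∈ set g) → T (edge H e) → set g ⊆ e → e ≡ set (d ◂ g)
      e≡ {e} {d} d∈e d∉g Ee g⊆e = sym (⊆∧∣≡∣⇒≡ ⊆e (trans (∣set∣ (d ◂ g) inj′) (sym (uniform H Ee))))
        where
        ⊆e : set (d ◂ g) ⊆ e
        ⊆e v∈ with ∈-set⁻ (d ◂ g) v∈
        ... | zero  , refl = d∈e
        ... | suc i , refl = g⊆e (∈-set⁺ g i)
        inj′ : Inj (d ◂ g)
        inj′ {zero}  {zero}  _  = refl
        inj′ {zero}  {suc j} eq = contradiction (subst (_∈ set g) (sym eq) (∈-set⁺ g j)) d∉g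
        inj′ {suc i} {zero}  eq = contradiction (subst (_∈ set g) eq (∈-set⁺ g i)) d∉g
        inj′ {suc i} {suc j} eq = cong suc (inj eq)

      extend : ∀ {e} → e ∈ˡ superedges → ∃ λ d → d ∈ˡ extensions × e ≡ set (d ◂ g)
      extend {e} e∈
        with e∈E , g⊆e ← ∈-filter⁻ (set g ⊆?_) {xs = edges H} e∈
        with Ee ← edges⁻ H e∈E
        with d , d∈e , d∉g ← fresh (subst (_≤ ∣ e ∣) (cong suc (sym (∣set∣ g inj))) (≤-reflexive (sym (uniform H Ee))))
        = d , ∈-filter⁺ (λ d → T? (edge H (set (d ◂ g)))) (∈-allFin d)
                (subst (T ∘ edge H) (e≡ d∈e d∉g Ee g⊆e) Ee)
            , e≡ d∈e d∉g Ee g⊆e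

      restrict : ∀ {d} → d ∈ˡ extensions → T (edge H (set (d ◂ g)))
      restrict d∈ = proj₂ (∈-filter⁻ (λ d → T? (edge H (set (d ◂ g)))) {xs = allFin n} d∈)

      same : ∀ {d d′ e} → d ∈ˡ extensions → d′ ∈ˡ extensions → e ≡ set (d ◂ g) → e ≡ set (d′ ◂ g) → d ≡ d′
      same {d} {d′} d∈ _ refl eq with ∈-set⁻ (d′ ◂ g) (subst (d ∈_) eq (∈-set⁺ (d ◂ g) zero))
      ... | zero  , d′≡d = sym d′≡d
      ... | suc i , gi≡d with () ← Edge⇒Inj H {d ◂ g} (restrict d∈) {suc i} {zero} gi≡d

    -- An edge containing `set g` has exactly one vertex outside it, so edges and extending vertices
    -- determine each other; `length-≤` is applied in both directions.
    codegree-set : codegree H (set g) ≡ ∑[ d < n ] 𝟙 (edge H (set (d ◂ g)))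
    codegree-set = trans (≤-antisym
      (length-≤ (λ e d → e ≡ set (d ◂ g)) superedges extensions
        (Unique.filter⁺ (set g ⊆?_) (Unique.filter⁺ (T? ∘ edge H) (subsets-unique n)))
        extend (λ _ _ p q → trans p (sym q)))
      (length-≤ (λ d e → e ≡ set (d ◂ g)) extensions superedges
        (Unique.filter⁺ (λ d → T? (edge H (set (d ◂ g)))) (Unique.allFin⁺ n))
        (λ {d} d∈ → set (d ◂ g) , ∈-filter⁺ (set g ⊆?_) (edges⁺ H (restrict d∈)) (tail-⊆ d) , refl)
        same))
      (length-filter-tabulate (λ d → edge H (set (d ◂ g))) id)

  -- Dropping position `i` leaves a set of the shadow. The count on the right includes `d = f i`,
  -- which gives back the edge itself.
  δ⁺≤degree : ∀ {f} → Edge H f → ∀ i → δ⁺ H ≤ ∑[ d < n ] 𝟙 (edge H (set (f [ i ≔ d ])))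
  δ⁺≤degree {f} Ef i = begin
    δ⁺ H                                            ≤⟨ δ⁺≤codegree H (shadow⁺ H (∣set∣ (removeAt f i) inj) Ef ⊆f) ⟩
    codegree H (set (removeAt f i))                 ≡⟨ codegree-set inj ⟩
    ∑[ d < n ] 𝟙 (edge H (set (d ◂ removeAt f i)))  ≡⟨ sum-cong-≗ {n} (λ d → cong (𝟙 ∘ edge H) (set-◂-removeAt f i d)) ⟩
    ∑[ d < n ] 𝟙 (edge H (set (f [ i ≔ d ])))       ∎
    where
    open ≤-Reasoning
    inj : Inj (removeAt f i)
    inj eq = punchIn-injective i _ _ (Edge⇒Inj H {f} Ef eq)
    ⊆f : set (removeAt f i) ⊆ set f
    ⊆f = set-⊆ {f = removeAt f i} {f} λ j → punchIn i j , refl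

fromTuples : ∀ {k m} → List (Fin k → Fin m) → Hypergraph k m
fromTuples {k} ts = fromList k (map set ts)

module _ {k m n} (ts : List (Fin k → Fin m)) (H : Hypergraph k n) where

  contains⁺ : {φ : Fin m → Fin n} → Inj φ → All (λ t → Edge H (φ ∘ t)) ts → Contains H (fromTuples ts)
  contains⁺ {φ} inj Ets = φ , inj , All.tabulate λ e∈ → image-edge (edges⁻ (fromTuples ts) e∈)
    where
    image-edge : ∀ {e} → T (edge (fromTuples ts) e) → T (edge H (image φ e))
    image-edge {e} Ee with e ∈ˡ? map set ts
    ... | yes e∈ with t , t∈ , refl ← ∈-map⁻ set e∈
      = subst (T ∘ edge H) (sym (image-set φ t)) (All.lookup Ets t∈)

  -- `fromList` discards sets of a size other than `k`; injectivity ensures that every tuple really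
  -- gives an edge of `fromTuples ts`.
  contains⁻ : All Inj ts → Contains H (fromTuples ts) →
              ∃ λ (φ : Fin m → Fin n) → Inj φ × All (λ t → Edge H (φ ∘ t)) ts
  contains⁻ injs (φ , inj , Es) = φ , inj , All.tabulate λ {t} t∈ →
    subst (T ∘ edge H) (image-set φ t) (All.lookup Es (edges⁺ (fromTuples ts)
      (Equivalence.from T-∧
        ( subst T (sym (dec-true (set t ∈ˡ? map set ts) (∈-map⁺ set t∈))) _
        , ≡⇒≡ᵇ ∣ set t ∣ k (∣set∣ t (All.lookup injs t∈))))))

-- The two forbidden hypergraphs

-- The two tuples differ by exchanging positions `i` and `j`. So `f i` can replace position `j` of
-- `f [ i ≔ d ]` as soon as `d` can replace position `j` of `f`.
set-swap : ∀ {m n} (f : Fin m → Fin n) {i j} d → i ≢ j → set (f [ i ≔ d ] [ j ≔ f i ]) ≡ set (f [ j ≔ d ])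
set-swap {m} {n} f {i} {j} d i≢j = ⊆-antisym
  (set-⊆ {f = L} {R} λ l → τ l , sym (L≗ l))
  (set-⊆ {f = R} {L} λ l → τ l , R≗ l)
  where
  L R : Fin m → Fin n
  L = f [ i ≔ d ] [ j ≔ f i ]
  R = f [ j ≔ d ]

  τ : Fin m → Fin m
  τ l with l ≟ i | l ≟ j
  ... | yes _ | _     = j
  ... | no _  | yes _ = i
  ... | no _  | no _  = l

  Li : L i ≡ d
  Li = trans (≔-miss (f [ i ≔ d ]) j i≢j) (≔-hit f i)

  L≗ : ∀ l → L l ≡ R (τ l)
  L≗ l with l ≟ i | l ≟ j
  ... | yes refl | _        = trans Li (sym (≔-hit f j))
  ... | no _     | yes refl = trans (≔-hit (f [ i ≔ d ]) j) (sym (≔-miss f j i≢j))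
  ... | no l≢i   | no l≢j   = trans (≔-miss (f [ i ≔ d ]) j l≢j) (trans (≔-miss f i l≢i) (sym (≔-miss f j l≢j)))

  R≗ : ∀ l → L (τ l) ≡ R l
  R≗ l with l ≟ i | l ≟ j
  ... | yes refl | _        = trans (≔-hit (f [ i ≔ d ]) j) (sym (≔-miss f j i≢j))
  ... | no _     | yes refl = trans Li (sym (≔-hit f j))
  ... | no l≢i   | no l≢j   = trans (≔-miss (f [ i ≔ d ]) j l≢j) (trans (≔-miss f i l≢i) (sym (≔-miss f j l≢j)))

-- Reordering the positions of a tuple

transpose-hit : ∀ {m} (i j : Fin m) → transpose i j ⟨$⟩ʳ i ≡ j
transpose-hit i j rewrite dec-true (i ≟ i) refl = refl

transpose-miss : ∀ {m} {i j l : Fin m} → l ≢ i → l ≢ j → transpose i j ⟨$⟩ʳ l ≡ l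
transpose-miss {i = i} {j} {l} l≢i l≢j rewrite dec-false (l ≟ i) l≢i | dec-false (l ≟ j) l≢j = refl

module _ {m} (π : Permutation′ m) where

  -- Transposing `s` with the preimage of `i` first affects no position but these two, so prescribed
  -- values can be imposed one after the other.
  redirect : Fin m → Fin m → Permutation′ m
  redirect s i = transpose s (π ⟨$⟩ˡ i) ∘ₚ π

  redirect-hit : ∀ s i → redirect s i ⟨$⟩ʳ s ≡ i
  redirect-hit s i = trans (cong (π ⟨$⟩ʳ_) (transpose-hit s _)) (inverseʳ π)

  redirect-miss : ∀ s {i l} → l ≢ s → π ⟨$⟩ʳ l ≢ i → redirect s i ⟨$⟩ʳ l ≡ π ⟨$⟩ʳ l
  redirect-miss s l≢s πl≢i = cong (π ⟨$⟩ʳ_)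
    (transpose-miss l≢s λ { refl → πl≢i (inverseʳ π) })

  set-permute : ∀ {n} (f : Fin m → Fin n) → set f ≡ set (f ∘ (π ⟨$⟩ʳ_))
  set-permute f = ⊆-antisym
    (set-⊆ {f = f} {f ∘ (π ⟨$⟩ʳ_)} λ i → π ⟨$⟩ˡ i , cong f (inverseʳ π))
    (set-⊆ {f = f ∘ (π ⟨$⟩ʳ_)} {f} λ i → π ⟨$⟩ʳ i , refl)

  permute-≔ : ∀ {A : Set} (f : Fin m → A) s {v} →
              f [ π ⟨$⟩ʳ s ≔ v ] ∘ (π ⟨$⟩ʳ_) ≗ (f ∘ (π ⟨$⟩ʳ_)) [ s ≔ v ]
  permute-≔ f s l with l ≟ s
  ... | yes refl = trans (≔-hit f (π ⟨$⟩ʳ l)) (sym (≔-hit (f ∘ (π ⟨$⟩ʳ_)) l))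
  ... | no  l≢s  = trans
    (≔-miss f (π ⟨$⟩ʳ s) λ eq → l≢s (trans (sym (inverseˡ π)) (trans (cong (π ⟨$⟩ˡ_) eq) (inverseˡ π))))
    (sym (≔-miss (f ∘ (π ⟨$⟩ʳ_)) s l≢s))

reorder₂ : ∀ {m} {a b i j : Fin m} → a ≢ b → i ≢ j →
           ∃ λ (π : Permutation′ m) → π ⟨$⟩ʳ a ≡ i × π ⟨$⟩ʳ b ≡ j
reorder₂ {m} {a} {b} {i} {j} a≢b i≢j
  = redirect π b j
  , trans (redirect-miss π b a≢b (i≢j ∘ trans (sym (redirect-hit idₚ a i)))) (redirect-hit idₚ a i)
  , redirect-hit π b j
  where
  π : Permutation′ m
  π = redirect idₚ a i

reorder₃ : ∀ {m} {a b c i j l : Fin m} → a ≢ b → a ≢ c → b ≢ c → i ≢ j → i ≢ l → j ≢ l →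
           ∃ λ (π : Permutation′ m) → π ⟨$⟩ʳ a ≡ i × π ⟨$⟩ʳ b ≡ j × π ⟨$⟩ʳ c ≡ l
reorder₃ {c = c} {l = l} a≢b a≢c b≢c i≢j i≢l j≢l with π , πa , πb ← reorder₂ a≢b i≢j
  = redirect π c l
  , trans (redirect-miss π c a≢c (i≢l ∘ trans (sym πa))) πa
  , trans (redirect-miss π c b≢c (j≢l ∘ trans (sym πb))) πb
  , redirect-hit π c l

module _ {k} (a b c : Fin k) where

  base₁ : Fin k → Fin (2 + k)
  base₁ l = suc (suc l)

  -- S consists of the positions other than `a` and `b`. The four further vertices are those at `a`
  -- and `b` together with `zero` and `suc zero`; the tuples run through their six pairs.
  tuples₁ : List (Fin k → Fin (2 + k))
  tuples₁ = base₁
          ∷ base₁ [ a ≔ zero ]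
          ∷ base₁ [ b ≔ zero ]
          ∷ base₁ [ b ≔ suc zero ]
          ∷ base₁ [ a ≔ suc zero ]
          ∷ base₁ [ a ≔ zero ] [ b ≔ suc zero ]
          ∷ []

  -- Any two vertices of F₁ lie in a common edge.
  tuples₁-injective : a ≢ b → ∀ {n} (ψ : Fin (2 + k) → Fin n) → All (λ t → Inj (ψ ∘ t)) tuples₁ → Inj ψ
  tuples₁-injective a≢b ψ (I ∷ Iaz ∷ Ibz ∷ Ibu ∷ Iau ∷ Iazbu ∷ []) = inj
    where
    -- The edge with `v` at `a` contains every base vertex but the one at `a`, which in turn lies in
    -- the edge with `v` at `b`.
    apart : ∀ v → Inj (ψ ∘ (base₁ [ a ≔ v ])) → Inj (ψ ∘ (base₁ [ b ≔ v ])) → ∀ l → ψ v ≢ ψ (base₁ l)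
    apart v Ia Ib l eq with l ≟ a
    ... | yes refl = a≢b (sym (Ib (trans (cong ψ (≔-hit base₁ b)) (trans eq (cong ψ (sym (≔-miss base₁ b a≢b)))))))
    ... | no  l≢a  = l≢a (Ia (trans (cong ψ (≔-miss base₁ a l≢a)) (trans (sym eq) (cong ψ (sym (≔-hit base₁ a))))))

    zu : ψ zero ≢ ψ (suc zero)
    zu eq = a≢b (Iazbu (trans
      (cong ψ (trans (≔-miss (base₁ [ a ≔ zero ]) b a≢b) (≔-hit base₁ a)))
      (trans eq (cong ψ (sym (≔-hit (base₁ [ a ≔ zero ]) b))))))

    inj : Inj ψ
    inj {zero}        {zero}        _  = refl
    inj {zero}        {suc zero}    eq = contradiction eq zu
    inj {zero}        {suc (suc l)} eq = contradiction eq (apart zero Iaz Ibz l)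
    inj {suc zero}    {zero}        eq = contradiction (sym eq) zu
    inj {suc zero}    {suc zero}    _  = refl
    inj {suc zero}    {suc (suc l)} eq = contradiction eq (apart (suc zero) Iau Ibu l)
    inj {suc (suc l)} {zero}        eq = contradiction (sym eq) (apart zero Iaz Ibz l)
    inj {suc (suc l)} {suc zero}    eq = contradiction (sym eq) (apart (suc zero) Iau Ibu l)
    inj {suc (suc l)} {suc (suc j)} eq = cong base₁ (I eq)

  F₁ : Hypergraph k (2 + k)
  F₁ = fromTuples tuples₁

  -- Block `zero` is the central edge and the other three are the satellites. The `r`-th root
  -- belongs to satellite `suc r`, where it replaces the entry at `a` or the one at `b`.
  block : Fin 4 → Fin k → Fin (4 * k)
  block = combine

  root : Fin 3 → Fin k
  root = a ◂ b ◂ c ◂ λ ()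

  rerooted : Fin k → Fin 3 → Fin k → Fin (4 * k)
  rerooted i r = block (suc r) [ i ≔ block zero (root r) ]

  tuples₂ : List (Fin k → Fin (4 * k))
  tuples₂ = tabulate block
         ++ tabulate (rerooted a)
         ++ tabulate (rerooted b)

  F₂ : Hypergraph k (4 * k)
  F₂ = fromTuples tuples₂

  module _ {n} (H : Hypergraph k n) where

    contains-F₁ : a ≢ b → (f : Fin k → Fin n) (z u : Fin n) →
                  Edge H f → Edge H (f [ a ≔ z ]) → Edge H (f [ b ≔ z ]) →
                  Edge H (f [ b ≔ u ]) → Edge H (f [ a ≔ u ]) →
                  Edge H (f [ a ≔ z ] [ b ≔ u ]) → Contains H F₁
    contains-F₁ a≢b f z u E Eaz Ebz Ebu Eau Eazbu =
      contains⁺ tuples₁ H (tuples₁-injective a≢b φ (All.map (λ {t} → Edge⇒Inj H {φ ∘ t}) Es)) Es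
      where
      φ : Fin (2 + k) → Fin n
      φ zero          = z
      φ (suc zero)    = u
      φ (suc (suc l)) = f l

      φ-≔ : ∀ i v → φ ∘ (base₁ [ i ≔ v ]) ≗ f [ i ≔ φ v ]
      φ-≔ = ∘-≔ φ base₁

      Es : All (λ t → Edge H (φ ∘ t)) tuples₁
      Es = E
         ∷ Edge-cong H (sym ∘ φ-≔ a zero) Eaz
         ∷ Edge-cong H (sym ∘ φ-≔ b zero) Ebz
         ∷ Edge-cong H (sym ∘ φ-≔ b (suc zero)) Ebu
         ∷ Edge-cong H (sym ∘ φ-≔ a (suc zero)) Eau
         ∷ Edge-cong H (λ l → sym (trans (∘-≔ φ (base₁ [ a ≔ zero ]) b (suc zero) l) (≔-cong (φ-≔ a zero) b l))) Eazbu
         ∷ []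

    contains-F₂ : (g : Fin 4 → Fin k → Fin n) → (∀ p → Edge H (g p)) →
                  (∀ r → Edge H (g (suc r) [ a ≔ g zero (root r) ])) →
                  (∀ r → Edge H (g (suc r) [ b ≔ g zero (root r) ])) →
                  (∀ {p q} → p Fin.< q → ∀ i j → g p i ≢ g q j) → Contains H F₂
    contains-F₂ g E E₀ E₁ disjoint = contains⁺ tuples₂ H {φ} inj
      (All.++⁺ (All.tabulate⁺ {f = block} λ p → Edge-cong H (sym ∘ φ-block p) (E p))
      (All.++⁺ (All.tabulate⁺ {f = rerooted a} λ r → Edge-cong H (sym ∘ φ-≔ a r) (E₀ r))
               (All.tabulate⁺ {f = rerooted b} λ r → Edge-cong H (sym ∘ φ-≔ b r) (E₁ r))))
      where
      φ : Fin (4 * k) → Fin n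
      φ x = uncurry g (remQuot {4} k x)

      φ-block : ∀ p → φ ∘ block p ≗ g p
      φ-block p l = cong (uncurry g) (remQuot-combine {4} p l)

      φ-≔ : ∀ i r → φ ∘ rerooted i r ≗ g (suc r) [ i ≔ g zero (root r) ]
      φ-≔ i r l = trans (∘-≔ φ (block (suc r)) i (block zero (root r)) l)
        (trans (≔-cong (φ-block (suc r)) i l) (cong (λ v → (g (suc r) [ i ≔ v ]) l) (φ-block zero (root r))))

      inj-pair : ∀ p i q j → g p i ≡ g q j → combine p i ≡ combine q j
      inj-pair p i q j eq with <-cmp p q
      ... | tri< p<q _ _  = contradiction eq (disjoint p<q i j)
      ... | tri> _ _ q<p  = contradiction (sym eq) (disjoint q<p j i)
      ... | tri≈ _ refl _ = cong (combine p) (Edge⇒Inj H {g p} (E p) eq)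

      inj : Inj φ
      inj {x} {y} eq = trans (sym (combine-remQuot {4} k x))
        (trans (inj-pair _ _ _ _ eq) (combine-remQuot {4} k y))

-- The upper bound

-- Permits a simultaneous case distinction for all vertices without excluded middle, since the final
-- goal is a contradiction.
¬¬-finite : ∀ {n} {P : Fin n → Set} → (∀ i → ¬ ¬ P i) → ¬ ¬ (∀ i → P i)
¬¬-finite {zero}  ¬¬p ¬∀ = ¬∀ λ ()
¬¬-finite {suc n} ¬¬p ¬∀ = ¬¬p zero λ p₀ → ¬¬-finite (¬¬p ∘ suc) λ ps →
  ¬∀ λ { zero → p₀ ; (suc i) → ps i }

sum≡0 : ∀ {n} (f : Fin n → ℕ) → sum f ≡ 0 → ∀ i → f i ≡ 0
sum≡0 f Σ≡0 i = n≤0⇒n≡0 (≤-trans (≤-∑ f i) (≤-reflexive Σ≡0))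

⟦≡⟧≡0⇒≢ : ∀ {n} {x v : Fin n} → ⟦ x ≡ v ⟧ ≡ 0 → x ≢ v
⟦≡⟧≡0⇒≢ ⟦⟧≡0 x≡v = contradiction (trans (sym (⟦≡⟧-yes x≡v)) ⟦⟧≡0) λ ()

m<1⇒m≡0 : ∀ {m} → m < 1 → m ≡ 0
m<1⇒m≡0 (s≤s z≤n) = refl

∑-linear : ∀ {n} (f g : Fin n → ℕ) c → ∑[ i < n ] (f i + c * g i) ≡ sum f + c * sum g
∑-linear f g c = trans (∑-distrib-+ f (λ i → c * g i)) (cong (sum f +_) (sym (*-distribˡ-sum c g)))

not-∨ : ∀ {P Q : Set} (P? : Dec P) (Q? : Dec Q) → T (not (does P? ∨ does Q?)) → ¬ P × ¬ Q
not-∨ (no ¬p) (no ¬q) _ = ¬p , ¬q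

-- If `x` or `y` vanished, the other one alone would be at most `r + c`; if `c` were positive,
-- `2 * c` would already reach `x + y`. This is used pointwise after a comparison of sums, with `c`
-- the cost of a vertex.
two-of-two : ∀ {r c x y} → x ≤ 1 → y ≤ 1 → x ≤ r + c → y ≤ r + c → r + 2 * c < x + y →
             0 < x × 0 < y × c ≡ 0
two-of-two {r} {c} {x} {y} x≤1 y≤1 x≤ y≤ lt = 0<x , 0<y , c≡0 c lt
  where
  r+c≤ : r + c ≤ r + 2 * c
  r+c≤ = +-monoʳ-≤ r (m≤m+n c _)
  0<x : 0 < x
  0<x = ≰⇒> λ { z≤n → <⇒≱ lt (≤-trans y≤ r+c≤) }
  0<y : 0 < y
  0<y = ≰⇒> λ { z≤n → <⇒≱ lt (≤-trans (≤-reflexive (+-identityʳ x)) (≤-trans x≤ r+c≤)) }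
  c≡0 : ∀ c → r + 2 * c < x + y → c ≡ 0
  c≡0 zero    _  = refl
  c≡0 (suc c) lt = contradiction (+-mono-≤ x≤1 y≤1)
    (<⇒≱ (≤-<-trans (≤-trans (*-monoʳ-≤ 2 (s≤s z≤n)) (m≤n+m (2 * suc c) r)) lt))

-- If one of the three vanished, the bounds on the other two would add up to at most the left-hand
-- side of the strict inequality.
three-of-three : ∀ {r c c′ x y w} → x ≤ r + c → y ≤ r + c → w ≤ r + c′ →
                 2 * r + c′ + 2 * c < x + y + w → 0 < x × 0 < y × 0 < w
three-of-three {r} {c} {c′} {x} {y} {w} x≤ y≤ w≤ lt =
    ≰⇒> (λ { z≤n → <⇒≱ lt (≤-trans (+-mono-≤ y≤ w≤) one) })
  , ≰⇒> (λ { z≤n → <⇒≱ lt (≤-trans (+-mono-≤ (≤-trans (≤-reflexive (+-identityʳ x)) x≤) w≤) one) })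
  , ≰⇒> λ { z≤n → <⇒≱ lt (≤-trans (≤-trans (≤-reflexive (+-identityʳ _)) (+-mono-≤ x≤ y≤)) two) }
  where
  one : (r + c) + (r + c′) ≤ 2 * r + c′ + 2 * c
  one = ≤-trans (m≤m+n _ c) (≤-reflexive (eq r c c′))
    where eq : ∀ r c c′ → (r + c) + (r + c′) + c ≡ 2 * r + c′ + 2 * c
          eq = solve-∀
  two : (r + c) + (r + c) ≤ 2 * r + c′ + 2 * c
  two = ≤-trans (m≤m+n _ c′) (≤-reflexive (eq r c c′))
    where eq : ∀ r c c′ → (r + c) + (r + c) + c′ ≡ 2 * r + c′ + 2 * c
          eq = solve-∀

module _ {k n} {a b c : Fin k} (a≢b : a ≢ b) (a≢c : a ≢ c) (b≢c : b ≢ c) (H : Hypergraph k n) where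

  private
    variable
      f : Fin k → Fin n

  -- v can be attached to an edge outside h the way each of the first three
  -- vertices of the central edge of F₂ is attached to a satellite edge.
  Rooted : Fin n → (Fin 3 → Fin k → Fin n) → Set
  Rooted v h = ∃ λ (g : Fin k → Fin n) →
    Edge H g × Edge H (g [ a ≔ v ]) × Edge H (g [ b ≔ v ]) × (∀ p i j → h p i ≢ g j)

  -- v remains rooted whatever 3k vertices are deleted.
  Robust : Fin n → Set
  Robust v = ∀ h → ¬ ¬ Rooted v h

  Blocked : Fin n → Set
  Blocked v = ∃ λ h → ¬ Rooted v h

  robust⊎blocked : ¬ ¬ (∀ v → Robust v ⊎ Blocked v)
  robust⊎blocked = ¬¬-finite λ v ¬either → ¬either (inj₁ λ h ¬R → ¬either (inj₂ (h , ¬R)))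

  permute-edge : ∀ (π : Permutation′ k) {f} → Edge H f → Edge H (f ∘ (π ⟨$⟩ʳ_))
  permute-edge π {f} = subst (T ∘ edge H) (set-permute π f)

  permute-edge-≔ : ∀ (π : Permutation′ k) {f} s {i v} → π ⟨$⟩ʳ s ≡ i → Edge H (f [ i ≔ v ]) →
                   Edge H ((f ∘ (π ⟨$⟩ʳ_)) [ s ≔ v ])
  permute-edge-≔ π {f} s {v = v} refl E =
    Edge-cong H {f = f [ π ⟨$⟩ʳ s ≔ v ] ∘ (π ⟨$⟩ʳ_)} (permute-≔ π f s)
      (permute-edge π {f [ π ⟨$⟩ʳ s ≔ v ]} E)

  contains-F₁′ : ∀ {i j} → i ≢ j → ∀ (f : Fin k → Fin n) z u →
                 Edge H f → Edge H (f [ i ≔ z ]) → Edge H (f [ j ≔ z ]) →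
                 Edge H (f [ j ≔ u ]) → Edge H (f [ i ≔ u ]) → Edge H (f [ i ≔ z ] [ j ≔ u ]) →
                 Contains H (F₁ a b c)
  contains-F₁′ i≢j f z u E Eiz Ejz Eju Eiu Eizju with π , refl , refl ← reorder₂ a≢b i≢j
    = contains-F₁ a b c H a≢b (f ∘ (π ⟨$⟩ʳ_)) z u (permute-edge π {f} E)
        (permute-edge-≔ π {f} a refl Eiz) (permute-edge-≔ π {f} b refl Ejz)
        (permute-edge-≔ π {f} b refl Eju) (permute-edge-≔ π {f} a refl Eiu)
        (Edge-cong H {f = (f [ π ⟨$⟩ʳ a ≔ z ] ∘ (π ⟨$⟩ʳ_)) [ b ≔ u ]} (≔-cong (permute-≔ π f a) b)
          (permute-edge-≔ π {f [ π ⟨$⟩ʳ a ≔ z ]} b refl Eizju))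

  module _ (F₂-free : ¬ Contains H (F₂ a b c)) where

    -- The edge becomes the central edge of a copy of F₂, and satellites are chosen one by one. The
    -- deleted vertices are those of the central edge and of the satellites found so far, with `g`
    -- repeated to fill up the three tuples.
    ¬three-robust : ∀ {i j l} → Edge H f → i ≢ j → i ≢ l → j ≢ l →
                    Robust (f i) → Robust (f j) → Robust (f l) → ⊥
    ¬three-robust {f = f} Ef i≢j i≢l j≢l Ri Rj Rl
      with π , refl , refl , refl ← reorder₃ a≢b a≢c b≢c i≢j i≢l j≢l
      = Ri (g ◂ g ◂ g ◂ λ ()) λ (g₁ , E₁ , E₁₀ , E₁₁ , avoid₁) →
        Rj (g ◂ g₁ ◂ g ◂ λ ()) λ (g₂ , E₂ , E₂₀ , E₂₁ , avoid₂) →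
        Rl (g ◂ g₁ ◂ g₂ ◂ λ ()) λ (g₃ , E₃ , E₃₀ , E₃₁ , avoid₃) →
        F₂-free (contains-F₂ a b c H (g ◂ g₁ ◂ g₂ ◂ g₃ ◂ λ ())
          (λ { zero → permute-edge π {f} Ef ; (suc zero) → E₁ ; (suc (suc zero)) → E₂ ; (suc (suc (suc zero))) → E₃ })
          (λ { zero → E₁₀ ; (suc zero) → E₂₀ ; (suc (suc zero)) → E₃₀ })
          (λ { zero → E₁₁ ; (suc zero) → E₂₁ ; (suc (suc zero)) → E₃₁ })
          (λ { {zero} {suc zero} _ → avoid₁ zero
             ; {zero} {suc (suc zero)} _ → avoid₂ zero
             ; {suc zero} {suc (suc zero)} _ → avoid₂ (suc zero)
             ; {zero} {suc (suc (suc zero))} _ → avoid₃ zero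
             ; {suc zero} {suc (suc (suc zero))} _ → avoid₃ (suc zero)
             ; {suc (suc zero)} {suc (suc (suc zero))} _ → avoid₃ (suc (suc zero))
             ; {suc _} {suc zero} (s≤s ())
             ; {suc (suc _)} {suc (suc zero)} (s≤s (s≤s ()))
             ; {suc (suc (suc _))} {suc (suc (suc zero))} (s≤s (s≤s (s≤s ()))) }))
      where
      g : Fin k → Fin n
      g = f ∘ (π ⟨$⟩ʳ_)


    -- Generic edges and their robust vertices

    module _ (F₁-free : ¬ Contains H (F₁ a b c)) (classify : ∀ v → Robust v ⊎ Blocked v) (η : ℕ) where

      private
        variable
          m : ℕ

      private
        robust# : ∀ {v} → Robust v ⊎ Blocked v → ℕ
        robust# (inj₁ _) = 1
        robust# (inj₂ _) = 0

        -- Counts how often `u` occurs among the `3 * k` vertices that witness that `v` is blocked;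
        -- an edge without obstacles of a blocked `v` cannot root `v`.
        obstacle : ∀ {v} → Robust v ⊎ Blocked v → Fin n → ℕ
        obstacle (inj₁ _)       u = 0
        obstacle (inj₂ (h , _)) u = ∑[ p < 3 ] fibre (h p) u

        ∑-obstacle : ∀ {v} (c : Robust v ⊎ Blocked v) → ∑[ u < n ] obstacle c u ≤ 3 * k
        ∑-obstacle (inj₁ _) = ≤-trans (≤-reflexive (∑-zero n)) z≤n
        ∑-obstacle (inj₂ (h , _)) = ≤-reflexive (trans (∑-comm {n} {3} (λ u p → fibre (h p) u))
          (trans (sum-cong-≗ {3} λ p → ∑-fibre-1 (h p)) (∑-const 3 k)))

      robust : Fin n → ℕ
      robust v = robust# (classify v)

      obstructs : Fin n → Fin n → ℕ
      obstructs v = obstacle (classify v)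

      load : Fin n → ℕ
      load u = ∑[ v < n ] obstructs v u

      heavy : Fin n → ℕ
      heavy u = 𝟙 (does (η <? load u))

      -- Vanishes when `d` is not heavy and there is no obstruction between `d` and the entries of
      -- `g` in either direction. As a weight, it enters the counting inequalities directly as an
      -- error term.
      cost : (Fin m → Fin n) → Fin n → ℕ
      cost {m} g d = heavy d + ∑[ i < m ] (obstructs (g i) d + obstructs d (g i))

      robust⁺ : ∀ {v} → Robust v → robust v ≡ 1
      robust⁺ {v} R with classify v
      ... | inj₁ _        = refl
      ... | inj₂ (h , ¬R) = contradiction ¬R (R h)

      robust⁻ : ∀ {v} → 0 < robust v → Robust v
      robust⁻ {v} 0<r with classify v
      ... | inj₁ R = R

      robust≤1 : ∀ v → robust v ≤ 1
      robust≤1 v with classify v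
      ... | inj₁ _ = ≤-refl
      ... | inj₂ _ = z≤n

      -- Double counting: the total load is at most `3 * k` per obstructed vertex, and every heavy
      -- vertex takes at least `suc η` of it.
      heavy-few : sum heavy * suc η ≤ n * (3 * k)
      heavy-few = begin
        sum heavy * suc η                 ≡⟨ *-comm (sum heavy) (suc η) ⟩
        suc η * sum heavy                 ≡⟨ *-distribˡ-sum (suc η) heavy ⟩
        ∑[ u < n ] (suc η * heavy u)      ≤⟨ ∑-mono heavy≤load ⟩
        ∑[ u < n ] load u                 ≡⟨ ∑-comm {n} {n} (λ u v → obstructs v u) ⟩
        ∑[ v < n ] ∑[ u < n ] obstructs v u  ≤⟨ ∑-bound {n} (λ v → ∑-obstacle (classify v)) ⟩
        n * (3 * k)                       ∎
        where
        open ≤-Reasoning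
        heavy≤load : ∀ u → suc η * heavy u ≤ load u
        heavy≤load u = by (η <? load u)
          where
          by : (η<l? : Dec (η < load u)) → suc η * 𝟙 (does η<l?) ≤ load u
          by (yes η<l) = ≤-trans (≤-reflexive (*-identityʳ (suc η))) η<l
          by (no _)    = ≤-trans (≤-reflexive (*-zeroʳ (suc η))) z≤n

      ∑-cost : (g : Fin m → Fin n) → (∀ i → load (g i) ≤ η) →
               ∑[ d < n ] cost g d ≤ sum heavy + m * (3 * k + η)
      ∑-cost {m} g light = begin
        ∑[ d < n ] cost g d
          ≡⟨ ∑-distrib-+ heavy (λ d → ∑[ i < m ] w i d) ⟩
        sum heavy + ∑[ d < n ] ∑[ i < m ] w i d
          ≡⟨ cong (sum heavy +_) (∑-comm {n} {m} (λ d i → w i d)) ⟩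
        sum heavy + ∑[ i < m ] ∑[ d < n ] w i d
          ≤⟨ +-monoʳ-≤ (sum heavy) (∑-bound {m} λ i → ≤-trans
               (≤-reflexive (∑-distrib-+ (obstructs (g i)) (λ d → obstructs d (g i))))
               (+-mono-≤ (∑-obstacle (classify (g i))) (light i))) ⟩
        sum heavy + m * (3 * k + η)  ∎
        where
        open ≤-Reasoning
        w : Fin m → Fin n → ℕ
        w i d = obstructs (g i) d + obstructs d (g i)

      cost≡0 : (g : Fin m → Fin n) {d : Fin n} → cost g d ≡ 0 →
               load d ≤ η × (∀ i → obstructs (g i) d ≡ 0 × obstructs d (g i) ≡ 0)
      cost≡0 {m} g {d} c≡0 = light (η <? load d) (m+n≡0⇒m≡0 (heavy d) c≡0) , λ i →
        m+n≡0⇒m≡0 _ (entry i) , m+n≡0⇒n≡0 (obstructs (g i) d) (entry i)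
        where
        entry : ∀ i → obstructs (g i) d + obstructs d (g i) ≡ 0
        entry = sum≡0 (λ i → obstructs (g i) d + obstructs d (g i)) (m+n≡0⇒n≡0 (heavy d) c≡0)
        light : (η<l? : Dec (η < load d)) → 𝟙 (does η<l?) ≡ 0 → load d ≤ η
        light (no η≮l) _ = ≮⇒≥ η≮l

      -- Genericity on a part of the positions only, because a good edge is built up position by
      -- position.
      GoodOn : (Fin k → Set) → (Fin k → Fin n) → Set
      GoodOn P f = (∀ {i} → P i → load (f i) ≤ η)
                 × (∀ {i j} → P i → P j → i ≢ j → obstructs (f i) (f j) ≡ 0)

      Good : (Fin k → Fin n) → Set
      Good = GoodOn (const Unit)

      good-≔ : ∀ {P Q : Fin k → Set} {i d} → (∀ {l} → Q l → l ≢ i → P l) → GoodOn P f → load d ≤ η →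
               (∀ {l} → P l → obstructs (f l) d ≡ 0 × obstructs d (f l) ≡ 0) → GoodOn Q (f [ i ≔ d ])
      good-≔ {f = f} {P} {Q} {i} {d} Q⇒P (light , compat) d-light d-compat = light′ , compat′
        where
        light′ : ∀ {l} → Q l → load ((f [ i ≔ d ]) l) ≤ η
        light′ {l} Ql with l ≟ i
        ... | yes refl = subst (λ v → load v ≤ η) (sym (≔-hit f i)) d-light
        ... | no  l≢i  = subst (λ v → load v ≤ η) (sym (≔-miss f i l≢i)) (light (Q⇒P Ql l≢i))
        compat′ : ∀ {l l′} → Q l → Q l′ → l ≢ l′ → obstructs ((f [ i ≔ d ]) l) ((f [ i ≔ d ]) l′) ≡ 0
        compat′ {l} {l′} Ql Ql′ l≢l′ with l ≟ i | l′ ≟ i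
        ... | yes refl | yes refl = contradiction refl l≢l′
        ... | yes refl | no  l′≢i = trans (cong₂ obstructs (≔-hit f i) (≔-miss f i l′≢i)) (proj₂ (d-compat (Q⇒P Ql′ l′≢i)))
        ... | no  l≢i  | yes refl = trans (cong₂ obstructs (≔-miss f i l≢i) (≔-hit f i)) (proj₁ (d-compat (Q⇒P Ql l≢i)))
        ... | no  l≢i  | no  l′≢i = trans (cong₂ obstructs (≔-miss f i l≢i) (≔-miss f i l′≢i))
                                         (compat (Q⇒P Ql l≢i) (Q⇒P Ql′ l′≢i) l≢l′)

      good-extend : ∀ {i d} → Good f → cost f d ≡ 0 → Good (f [ i ≔ d ])
      good-extend {f = f} good c≡0 with d-light , d-compat ← cost≡0 f c≡0 =
        good-≔ {f = f} (λ _ _ → _) good d-light λ {l} _ → d-compat l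

      -- If `v` were blocked by `h`, the absence of obstructions would make `g` disjoint from `h`,
      -- and `g` would root `v` outside `h` after all.
      rooted⇒robust : ∀ {g : Fin k → Fin n} {v i j} → Edge H g → i ≢ j →
                      Edge H (g [ i ≔ v ]) → Edge H (g [ j ≔ v ]) →
                      (∀ l → obstructs v (g l) ≡ 0) → Robust v
      rooted⇒robust {g} {v} E i≢j Ei Ej free with π , πi , πj ← reorder₂ a≢b i≢j = go (classify v) free
        where
        go : (c : Robust v ⊎ Blocked v) → (∀ l → obstacle c (g l) ≡ 0) → Robust v
        go (inj₁ R) _ = R
        go (inj₂ (h , ¬R)) free = contradiction
          ( g ∘ (π ⟨$⟩ʳ_) , permute-edge π {g} E
          , permute-edge-≔ π {g} a πi Ei , permute-edge-≔ π {g} b πj Ej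
          , λ p i l → ⟦≡⟧≡0⇒≢ (sum≡0 (λ i → ⟦ h p i ≡ g (π ⟨$⟩ʳ l) ⟧)
              (sum≡0 (λ p → fibre (h p) (g (π ⟨$⟩ʳ l))) (free (π ⟨$⟩ʳ l)) p) i)) ¬R

      -- The edge `f [ i ≔ d ]` roots `f i`: putting `f i` back at `i` restores `f`, and putting it
      -- at `j` gives `f [ j ≔ d ]` by `set-swap`.
      twin⇒robust : ∀ {i j d} → Good f → Edge H f → cost f d ≡ 0 → i ≢ j →
                    Edge H (f [ i ≔ d ]) → Edge H (f [ j ≔ d ]) → Robust (f i)
      twin⇒robust {f = f} {i} {j} {d} good E c≡0 i≢j Ei Ej
        with _ , d-compat ← cost≡0 f c≡0
        = rooted⇒robust {g = f [ i ≔ d ]} Ei i≢j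
            (Edge-cong H {f = f} back E)
            (subst (T ∘ edge H) (sym (set-swap f d i≢j)) Ej)
            free
        where
        back : f ≗ f [ i ≔ d ] [ i ≔ f i ]
        back l with l ≟ i
        ... | yes refl = sym (≔-hit (f [ i ≔ d ]) i)
        ... | no  l≢i  = sym (trans (≔-miss (f [ i ≔ d ]) i l≢i) (≔-miss f i l≢i))
        free : ∀ l → obstructs (f i) ((f [ i ≔ d ]) l) ≡ 0
        free l with l ≟ i
        ... | yes refl = trans (cong (obstructs (f i)) (≔-hit f i)) (proj₁ (proj₂ (cost≡0 f c≡0) i))
        ... | no  l≢i  = trans (cong (obstructs (f i)) (≔-miss f i l≢i)) (proj₂ good _ _ (l≢i ∘ sym))

      ext : (Fin k → Fin n) → Fin k → Fin n → ℕ
      ext f i d = 𝟙 (edge H (set (f [ i ≔ d ])))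

      -- `D` is a lower bound for all degrees and `ω` bounds the total cost against a good tuple.
      -- The inequality `ω < D` provides replacements of cost 0, and `n + k * ω < k * D` provides a
      -- vertex that can replace two positions.
      module _ {D ω : ℕ} (degree : ∀ {f} → Edge H f → ∀ i → D ≤ ∑[ d < n ] ext f i d)
               (cheap : sum heavy + k * (3 * k + η) ≤ ω) (ω<D : ω < D) (n+kω<kD : n + k * ω < k * D) where

        ∑-cost≤ω : Good f → ∑[ d < n ] cost f d ≤ ω
        ∑-cost≤ω {f = f} good = ≤-trans (∑-cost f λ i → proj₁ good _) cheap

        -- One position is replaced at a time. The new vertex is compared with the first `j` entries
        -- only, as later ones are still to be replaced. Those entries are light, so the total cost
        -- is at most `ω < D` and some extending vertex costs nothing.
        good-edge-below : ∀ j → j ≤ k → (∃ λ (f : Fin k → Fin n) → Edge H f) →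
                          ∃ λ (f : Fin k → Fin n) → Edge H f × GoodOn (λ i → toℕ i < j) f
        good-edge-below zero    _   (f , E) = f , E , (λ ()) , λ ()
        good-edge-below (suc j) j<k start
          with f , E , good ← good-edge-below j (<⇒≤ j<k) start
          with d , lt ← ∑<∑⇒∃< (cost (f ∘ λ i → inject≤ i (<⇒≤ j<k))) (ext f (fromℕ< j<k))
                 (≤-<-trans (≤-trans (∑-cost (f ∘ λ i → inject≤ i (<⇒≤ j<k))
                   λ i → proj₁ good (subst (_< j) (sym (toℕ-inject≤ i (<⇒≤ j<k))) (toℕ<n i)))
                   (≤-trans (+-monoʳ-≤ (sum heavy) (*-monoˡ-≤ (3 * k + η) (<⇒≤ j<k))) cheap))
                   (<-≤-trans ω<D (degree E (fromℕ< j<k))))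
          with d-light , d-compat ← cost≡0 (f ∘ λ i → inject≤ i (<⇒≤ j<k))
                 (m<1⇒m≡0 (<-≤-trans lt (𝟙≤1 _)))
          = f [ fromℕ< j<k ≔ d ] , 𝟙-true (≤-<-trans z≤n lt)
          , good-≔ {f = f} below good d-light λ {l} l<j →
              subst (λ i → obstructs (f i) d ≡ 0 × obstructs d (f i) ≡ 0)
                (toℕ-injective (trans (toℕ-inject≤ (fromℕ< l<j) (<⇒≤ j<k)) (toℕ-fromℕ< l<j)))
                (d-compat (fromℕ< l<j))
          where
          below : ∀ {l} → toℕ l < suc j → l ≢ fromℕ< j<k → toℕ l < j
          below (s≤s l≤j) l≢ = ≤∧≢⇒< l≤j λ l≡j → l≢ (toℕ-injective (trans l≡j (sym (toℕ-fromℕ< j<k))))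

        good-edge : (∃ λ (f : Fin k → Fin n) → Edge H f) → ∃ λ (f : Fin k → Fin n) → Edge H f × Good f
        good-edge start with f , E , light , compat ← good-edge-below k ≤-refl start
          = f , E , (λ {i} _ → light (toℕ<n i)) , λ {i} {j} _ _ → compat (toℕ<n i) (toℕ<n j)

        ∑-1+cost : Good f → ∑[ d < n ] (1 + k * cost f d) ≤ n + k * ω
        ∑-1+cost {f = f} good = ≤-trans (≤-reflexive (∑-linear {n} (const 1) (cost f) k))
          (+-mono-≤ (≤-reflexive (trans (∑-const n 1) (*-identityʳ n))) (*-monoʳ-≤ k (∑-cost≤ω {f = f} good)))

        -- The `k` positions admit at least `k * D` replacements in total, so on average a vertex
        -- replaces more than one position, even after paying `k` for each unit of cost.
        cheap-twin : Good f → Edge H f → ∃ λ d → 1 + k * cost f d < ∑[ i < k ] ext f i d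
        cheap-twin {f = f} good E = ∑<∑⇒∃< (λ d → 1 + k * cost f d) (λ d → ∑[ i < k ] ext f i d) (begin-strict
          ∑[ d < n ] (1 + k * cost f d)    ≤⟨ ∑-1+cost {f = f} good ⟩
          n + k * ω                        <⟨ n+kω<kD ⟩
          k * D                            ≡⟨ ∑-const k D ⟨
          ∑[ i < k ] D                     ≤⟨ ∑-mono {k} (degree E) ⟩
          ∑[ i < k ] ∑[ d < n ] ext f i d  ≡⟨ ∑-comm {k} {n} (ext f) ⟩
          ∑[ d < n ] ∑[ i < k ] ext f i d  ∎)
          where open ≤-Reasoning

        robust-pair : Good f → Edge H f → ∃ λ i → ∃ λ j → i ≢ j × Robust (f i) × Robust (f j)
        robust-pair {f = f} good E with d , lt ← cheap-twin {f = f} good E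
          with cost f d in c≡
        -- A vertex replaces at most `k` positions, so the factor `k` rules out a positive cost.
        ... | suc c = contradiction (<-≤-trans lt (∑-bound {k} λ i → 𝟙≤1 _))
                        (≤⇒≯ (m≤n⇒m≤1+n (*-monoʳ-≤ k (s≤s z≤n))))
        ... | zero with i , j , i≢j , Ei , Ej ← ∑>1⇒distinct (λ i → edge H (set (f [ i ≔ d ])))
                          (subst (_< ∑[ i < k ] ext f i d) (cong suc (*-zeroʳ k)) lt)
          = i , j , i≢j , twin⇒robust {f = f} good E c≡ i≢j Ei Ej , twin⇒robust {f = f} good E c≡ (i≢j ∘ sym) Ej Ei

        private
          elsewhere : (i j l : Fin k) → Bool
          elsewhere i j l = not (does (i ≟ l) ∨ does (j ≟ l))

          moves : (Fin k → Fin n) → Fin k → Fin k → Fin k → Fin n → Bool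
          moves f i j l d = elsewhere i j l ∧ edge H (set (f [ l ≔ d ]))

          moves⁻ : ∀ (f : Fin k → Fin n) {i j l d} → T (moves f i j l d) → i ≢ l × j ≢ l × Edge H (f [ l ≔ d ])
          moves⁻ f {i} {j} {l} t with p , q ← Equivalence.to (T-∧ {elsewhere i j l}) t
            with i≢l , j≢l ← not-∨ (i ≟ l) (j ≟ l) p = i≢l , j≢l , q

          -- The excluded positions `i` and `j` are charged `D` instead, so that the sum over all
          -- `l` loses only `2 * D`.
          D≤moves : Edge H f → ∀ i j l → D ≤ ∑[ d < n ] 𝟙 (moves f i j l d) + (⟦ i ≡ l ⟧ + ⟦ j ≡ l ⟧) * D
          D≤moves {f = f} E i j l with does (i ≟ l) | does (j ≟ l)
          ... | true  | _     = m≤n⇒m≤o+n (∑[ d < n ] 0) (m≤m+n D _)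
          ... | false | true  = m≤n⇒m≤o+n (∑[ d < n ] 0) (m≤m+n D _)
          ... | false | false = m≤n⇒m≤n+o 0 (degree E l)

          kD≤moves : Edge H f → ∀ i j → k * D ≤ ∑[ d < n ] ∑[ l < k ] 𝟙 (moves f i j l d) + 2 * D
          kD≤moves {f = f} E i j = begin
            k * D                                       ≡⟨ ∑-const k D ⟨
            ∑[ l < k ] D                                ≤⟨ ∑-mono {k} (D≤moves {f = f} E i j) ⟩
            ∑[ l < k ] (∑[ d < n ] 𝟙 (moves f i j l d) + δ l * D)
              ≡⟨ ∑-distrib-+ {k} (λ l → ∑[ d < n ] 𝟙 (moves f i j l d)) (λ l → δ l * D) ⟩
            ∑[ l < k ] ∑[ d < n ] 𝟙 (moves f i j l d) + ∑[ l < k ] (δ l * D)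
              ≡⟨ cong₂ _+_ (∑-comm {k} {n} (λ l d → 𝟙 (moves f i j l d))) (sym (*-distribʳ-sum D δ)) ⟩
            ∑[ d < n ] ∑[ l < k ] 𝟙 (moves f i j l d) + sum δ * D
              ≡⟨ cong (λ x → ∑[ d < n ] ∑[ l < k ] 𝟙 (moves f i j l d) + x * D)
                   (trans (∑-distrib-+ {k} (λ l → ⟦ i ≡ l ⟧) (λ l → ⟦ j ≡ l ⟧)) (cong₂ _+_ (∑-⟦≡⟧ i) (∑-⟦≡⟧ j))) ⟩
            ∑[ d < n ] ∑[ l < k ] 𝟙 (moves f i j l d) + 2 * D ∎
            where
            open ≤-Reasoning
            δ : Fin k → ℕ
            δ l = ⟦ i ≡ l ⟧ + ⟦ j ≡ l ⟧

        module _ {i j} (good : Good f) (E : Edge H f) (i≢j : i ≢ j) (Ri : Robust (f i)) (Rj : Robust (f j)) where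

          -- A cheap vertex is robust or can replace at most one of the
          -- remaining vertices of the edge, and not both.
          moves+robust : ∀ d → ∑[ l < k ] 𝟙 (moves f i j l d) + robust d ≤ 1 + k * cost f d
          moves+robust d with cost f d in c≡
          ... | suc x = ≤-trans (+-mono-≤ (≤-trans (∑-bound {k} λ l → 𝟙≤1 (moves f i j l d)) (*-monoʳ-≤ k (s≤s z≤n))) (robust≤1 d))
                          (≤-reflexive (+-comm (k * suc x) 1))
          ... | zero = ≤-trans (≮⇒≥ ¬two) (m≤m+n 1 _)
            where
            ¬two : ¬ 1 < ∑[ l < k ] 𝟙 (moves f i j l d) + robust d
            -- If `d` is not robust, it replaces two positions besides `i` and `j`, so the vertex
            -- there is robust by `twin⇒robust` and `f` has three robust vertices. If `d` is robust,
            -- inserting it at such a position gives an edge with three.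
            ¬two lt with 0 <? robust d
            ... | no  ¬0<r
              with l , l′ , l≢l′ , p , q ← ∑>1⇒distinct (λ l → moves f i j l d)
                     (subst (1 <_) (trans (cong (∑[ l < k ] 𝟙 (moves f i j l d) +_) (n≤0⇒n≡0 (≮⇒≥ ¬0<r))) (+-identityʳ _)) lt)
              with i≢l , j≢l , El ← moves⁻ f {i} {j} p | _ , _ , El′ ← moves⁻ f {i} {j} q
              = ¬three-robust {f = f} E i≢j i≢l j≢l Ri Rj (twin⇒robust {f = f} good E c≡ l≢l′ El El′)
            ... | yes 0<r
              with l , 0<m ← ∑<∑⇒∃< (const 0) (λ l → 𝟙 (moves f i j l d))
                     (subst (_< ∑[ l < k ] 𝟙 (moves f i j l d)) (sym (∑-zero k))
                       (+-cancelʳ-< 1 0 _ (<-≤-trans lt (+-monoʳ-≤ _ (robust≤1 d)))))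
              with i≢l , j≢l , El ← moves⁻ f {i} {j} (𝟙-true 0<m)
              = ¬three-robust {f = f [ l ≔ d ]} El i≢j i≢l j≢l
                  (subst Robust (sym (≔-miss f l i≢l)) Ri) (subst Robust (sym (≔-miss f l j≢l)) Rj)
                  (subst Robust (sym (≔-hit f l)) (robust⁻ 0<r))

          -- The positions besides `i` and `j` have `(k - 2) D` replacements, which by
          -- `moves+robust` are essentially distinct and not robust. This leaves `n - (k - 2) D`
          -- vertices, up to an error of `k * ω`.
          robust-few : k * D + sum robust ≤ n + k * ω + 2 * D
          robust-few = begin
            k * D + sum robust                    ≤⟨ +-monoˡ-≤ (sum robust) (kD≤moves {f = f} E i j) ⟩
            sum M + 2 * D + sum robust            ≡⟨ swap (sum M) (2 * D) (sum robust) ⟩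
            sum M + sum robust + 2 * D            ≡⟨ cong (_+ 2 * D) (∑-distrib-+ M robust) ⟨
            ∑[ d < n ] (M d + robust d) + 2 * D   ≤⟨ +-monoˡ-≤ (2 * D) (∑-mono moves+robust) ⟩
            ∑[ d < n ] (1 + k * cost f d) + 2 * D ≤⟨ +-monoˡ-≤ (2 * D) (∑-1+cost {f = f} good) ⟩
            n + k * ω + 2 * D                     ∎
            where
            open ≤-Reasoning
            M : Fin n → ℕ
            M d = ∑[ l < k ] 𝟙 (moves f i j l d)
            swap : ∀ x y z → x + y + z ≡ x + z + y
            swap = solve-∀

          -- The edge `f [ i ≔ d ]` is good again and has two robust vertices. If `d` were not among
          -- them, one would sit at a position other than `i` and `j` and be a third robust vertex
          -- of `f`.
          ext⇒robust : ∀ {d} → cost f d ≡ 0 → Edge H (f [ i ≔ d ]) → Robust d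
          ext⇒robust {d} c≡0 Ei
            with p , q , p≢q , Rp , Rq ← robust-pair {f = f [ i ≔ d ]} (good-extend {f = f} good c≡0) Ei
            with i ≟ p | i ≟ q
          ... | yes refl | _        = subst Robust (≔-hit f i) Rp
          ... | no _     | yes refl = subst Robust (≔-hit f i) Rq
          ... | no i≢p   | no i≢q with j ≟ p
          ...   | no j≢p = contradiction (subst Robust (≔-miss f i (i≢p ∘ sym)) Rp)
                             (¬three-robust {f = f} E i≢j i≢p j≢p Ri Rj)
          ...   | yes refl = contradiction (subst Robust (≔-miss f i (i≢q ∘ sym)) Rq)
                             (¬three-robust {f = f} E i≢j i≢q p≢q Ri Rj)

          ext≤robust+cost : ∀ d → ext f i d ≤ robust d + cost f d
          ext≤robust+cost d with cost f d in c≡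
          ... | suc x = ≤-trans (𝟙≤1 _) (≤-trans (s≤s z≤n) (m≤n+m (suc x) (robust d)))
          ... | zero  = by (edge H (set (f [ i ≔ d ]))) (robust⁺ ∘ ext⇒robust c≡)
            where
            by : ∀ e → (T e → robust d ≡ 1) → 𝟙 e ≤ robust d + 0
            by true  r = subst (λ x → 1 ≤ x + 0) (sym (r _)) ≤-refl
            by false _ = z≤n

        -- In the link of S, `ext f i` and `ext f j` are the neighbourhoods of `f j` and `f i`. Both
        -- lie essentially among the robust vertices, which number less than `2 * D`, so they meet.
        two-replacements : ∀ {i j} → Good f → Edge H f → i ≢ j → Robust (f i) → Robust (f j) →
                           sum robust + 2 * ω < 2 * D →
                           ∃ λ z → cost f z ≡ 0 × Robust z × Edge H (f [ i ≔ z ]) × Edge H (f [ j ≔ z ])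
        two-replacements {f = f} {i} {j} good E i≢j Ri Rj R+2ω<2D = pick (∑<∑⇒∃< L U (begin-strict
          sum L                            ≡⟨ ∑-linear robust (cost f) 2 ⟩
          sum robust + 2 * sum (cost f)    ≤⟨ +-monoʳ-≤ (sum robust) (*-monoʳ-≤ 2 (∑-cost≤ω {f = f} good)) ⟩
          sum robust + 2 * ω               <⟨ R+2ω<2D ⟩
          2 * D                            ≡⟨ cong (D +_) (+-identityʳ D) ⟩
          D + D                            ≤⟨ +-mono-≤ (degree E i) (degree E j) ⟩
          sum (ext f i) + sum (ext f j)    ≡⟨ ∑-distrib-+ (ext f i) (ext f j) ⟨
          sum U                            ∎))
          where
          open ≤-Reasoning
          L U : Fin n → ℕ
          L d = robust d + 2 * cost f d
          U d = ext f i d + ext f j d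
          pick : (∃ λ z → L z < U z) → ∃ λ z → cost f z ≡ 0 × Robust z × Edge H (f [ i ≔ z ]) × Edge H (f [ j ≔ z ])
          pick (z , lt) = z , c≡0 , ext⇒robust {f = f} good E i≢j Ri Rj c≡0 Ei , Ei , 𝟙-true (proj₁ (proj₂ arith))
            where
            arith : 0 < ext f i z × 0 < ext f j z × cost f z ≡ 0
            arith = two-of-two {robust z} {cost f z} (𝟙≤1 _) (𝟙≤1 _) (ext≤robust+cost {f = f} good E i≢j Ri Rj z)
              (ext≤robust+cost {f = f} good E (i≢j ∘ sym) Rj Ri z) lt
            Ei : Edge H (f [ i ≔ z ])
            Ei = 𝟙-true (proj₁ arith)
            c≡0 : cost f z ≡ 0
            c≡0 = proj₂ (proj₂ arith)

        -- The neighbourhoods of `f i`, `f j` and `z` in the link lie essentially among fewer than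
        -- `3 * D / 2` robust vertices, so they have a common vertex. Two of them are measured by
        -- `cost f` and one by `cost f′`.
        complete-K₄ : ∀ {i j z} → Good f → Edge H f → i ≢ j → Robust (f i) → Robust (f j) →
                      cost f z ≡ 0 → Robust z → Edge H (f [ i ≔ z ]) →
                      2 * sum robust + 3 * ω < 3 * D →
                      ∃ λ u → Edge H (f [ i ≔ u ]) × Edge H (f [ j ≔ u ]) × Edge H (f [ i ≔ z ] [ j ≔ u ])
        complete-K₄ {f = f} {i} {j} {z} good E i≢j Ri Rj c≡0 Rz Eiz 2R+3ω<3D = pick (∑<∑⇒∃< L U (begin-strict
          sum L
            ≡⟨ ∑-linear (λ d → 2 * robust d + cost f′ d) (cost f) 2 ⟩
          sum (λ d → 2 * robust d + cost f′ d) + 2 * sum (cost f)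
            ≡⟨ cong (_+ 2 * sum (cost f)) (trans (∑-distrib-+ (λ d → 2 * robust d) (cost f′))
                 (cong (_+ sum (cost f′)) (sym (*-distribˡ-sum 2 robust)))) ⟩
          2 * sum robust + sum (cost f′) + 2 * sum (cost f)
            ≤⟨ +-mono-≤ (+-monoʳ-≤ (2 * sum robust) (∑-cost≤ω {f = f′} good′)) (*-monoʳ-≤ 2 (∑-cost≤ω {f = f} good)) ⟩
          2 * sum robust + ω + 2 * ω
            ≡⟨ +-assoc (2 * sum robust) ω (2 * ω) ⟩
          2 * sum robust + 3 * ω
            <⟨ 2R+3ω<3D ⟩
          3 * D
            ≡⟨ triple D ⟩
          D + D + D
            ≤⟨ +-mono-≤ (+-mono-≤ (degree E i) (degree E j)) (degree Eiz j) ⟩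
          sum (ext f i) + sum (ext f j) + sum (ext f′ j)
            ≡⟨ cong (_+ sum (ext f′ j)) (∑-distrib-+ (ext f i) (ext f j)) ⟨
          sum (λ d → ext f i d + ext f j d) + sum (ext f′ j)
            ≡⟨ ∑-distrib-+ (λ d → ext f i d + ext f j d) (ext f′ j) ⟨
          sum U ∎))
          where
          open ≤-Reasoning
          f′ : Fin k → Fin n
          f′ = f [ i ≔ z ]
          good′ : Good f′
          good′ = good-extend {f = f} good c≡0
          L U : Fin n → ℕ
          L d = 2 * robust d + cost f′ d + 2 * cost f d
          U d = ext f i d + ext f j d + ext f′ j d
          triple : ∀ x → 3 * x ≡ x + x + x
          triple = solve-∀
          pick : (∃ λ u → L u < U u) → ∃ λ u → Edge H (f [ i ≔ u ]) × Edge H (f [ j ≔ u ]) × Edge H (f′ [ j ≔ u ])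
          pick (u , lt)
            with p , q , r ← three-of-three {robust u} {cost f u} {cost f′ u}
                   (ext≤robust+cost {f = f} good E i≢j Ri Rj u)
                   (ext≤robust+cost {f = f} good E (i≢j ∘ sym) Rj Ri u)
                   (ext≤robust+cost {f = f′} good′ Eiz (i≢j ∘ sym)
                     (subst Robust (sym (≔-miss f i (i≢j ∘ sym))) Rj) (subst Robust (sym (≔-hit f i)) Rz) u)
                   lt
            = u , 𝟙-true p , 𝟙-true q , 𝟙-true r

        absurd : (∃ λ (f : Fin k → Fin n) → Edge H f) →
                 (∀ {R} → k * D + R ≤ n + k * ω + 2 * D → R + 2 * ω < 2 * D × 2 * R + 3 * ω < 3 * D) → ⊥
        absurd start room =
          let f , E , good = good-edge start
              i , j , i≢j , Ri , Rj = robust-pair {f = f} good E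
              lt₂ , lt₃ = room (robust-few {f = f} good E i≢j Ri Rj)
              z , c≡0 , Rz , Eiz , Ejz = two-replacements {f = f} good E i≢j Ri Rj lt₂
              u , Eiu , Eju , Eizju = complete-K₄ {f = f} good E i≢j Ri Rj c≡0 Rz Eiz lt₃
          in F₁-free (contains-F₁′ i≢j f z u E Eiz Ejz Eju Eiu Eizju)

-- Numerical conditions for large n

n<[1+n/c]*c : ∀ n c′ → n < suc (n / suc c′) * suc c′
n<[1+n/c]*c n c′ = ≤-trans (≤-reflexive (cong suc (m≡m%n+[m/n]*n n (suc c′))))
  (+-monoˡ-≤ (n / suc c′ * suc c′) (m%n<n n (suc c′)))

-- `slack` is the factor by which `ω` has to stay below `4 * n` in `ω-small`. `threshold` exceeds
-- `slack` times the part of `ω` that does not depend on `n`, and its summand 1 keeps `n` positive.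
slack threshold : ℕ → ℕ
slack K = (10 + 4 * K) * (1 + 4 * K)
threshold K = 1 + slack K * (3 * suc K * suc (slack K * suc K) + suc K * (3 * suc K))

module _ (K n D : ℕ) (4n<[1+4K]D : 4 * n < (1 + 4 * K) * D) where

  ω-small : ∀ {ω} → slack K * ω ≤ 4 * n → (10 + 4 * K) * ω < D
  ω-small {ω} le = *-cancelˡ-< (1 + 4 * K) _ _ (≤-<-trans (≤-trans (≤-reflexive (eq K ω)) le) 4n<[1+4K]D)
    where
    eq : ∀ K ω → (1 + 4 * K) * ((10 + 4 * K) * ω) ≡ (10 + 4 * K) * (1 + 4 * K) * ω
    eq = solve-∀

  module _ (ω : ℕ) ([10+4K]ω<D : (10 + 4 * K) * ω < D) where

    n+kω<kD : n + suc K * ω < suc K * D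
    n+kω<kD = *-cancelˡ-< 4 _ _ (begin-strict
      4 * (n + suc K * ω)               ≤⟨ m≤m+n _ (6 * ω) ⟩
      4 * (n + suc K * ω) + 6 * ω       ≡⟨ eq₁ n K ω ⟩
      4 * n + (10 + 4 * K) * ω          <⟨ +-mono-< 4n<[1+4K]D [10+4K]ω<D ⟩
      (1 + 4 * K) * D + D               ≤⟨ m≤m+n _ (2 * D) ⟩
      (1 + 4 * K) * D + D + 2 * D       ≡⟨ eq₂ K D ⟩
      4 * (suc K * D)                   ∎)
      where
      open ≤-Reasoning
      eq₁ : ∀ n K ω → 4 * (n + (1 + K) * ω) + 6 * ω ≡ 4 * n + (10 + 4 * K) * ω
      eq₁ = solve-∀
      eq₂ : ∀ K D → (1 + 4 * K) * D + D + 2 * D ≡ 4 * ((1 + K) * D)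
      eq₂ = solve-∀

    ω<D : ω < D
    ω<D = ≤-<-trans (m≤m+n ω _) [10+4K]ω<D

    module _ (R : ℕ) (le : suc K * D + R ≤ n + suc K * ω + 2 * D) where

      -- The error has the factor `4 * suc K` from `le` and 6 from twice the term `3 * ω` in
      -- `complete-K₄`, which explains `10 + 4 * K`.
      4R+6ω<6D : 4 * R + 6 * ω < 6 * D
      4R+6ω<6D = +-cancelˡ-< ((4 + 4 * K) * D) _ _ (begin-strict
        (4 + 4 * K) * D + (4 * R + 6 * ω)            ≡⟨ eq₁ K D R ω ⟩
        4 * (suc K * D + R) + 6 * ω                  ≤⟨ +-monoˡ-≤ (6 * ω) (*-monoʳ-≤ 4 le) ⟩
        4 * (n + suc K * ω + 2 * D) + 6 * ω          ≡⟨ eq₂ n K ω D ⟩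
        4 * n + (10 + 4 * K) * ω + 8 * D             <⟨ +-monoˡ-< (8 * D) (+-mono-< 4n<[1+4K]D [10+4K]ω<D) ⟩
        (1 + 4 * K) * D + D + 8 * D                  ≡⟨ eq₃ K D ⟩
        (4 + 4 * K) * D + 6 * D                      ∎)
        where
        open ≤-Reasoning
        eq₁ : ∀ K D R ω → (4 + 4 * K) * D + (4 * R + 6 * ω) ≡ 4 * ((1 + K) * D + R) + 6 * ω
        eq₁ = solve-∀
        eq₂ : ∀ n K ω D → 4 * (n + (1 + K) * ω + 2 * D) + 6 * ω ≡ 4 * n + (10 + 4 * K) * ω + 8 * D
        eq₂ = solve-∀
        eq₃ : ∀ K D → (1 + 4 * K) * D + D + 8 * D ≡ (4 + 4 * K) * D + 6 * D
        eq₃ = solve-∀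

      room : R + 2 * ω < 2 * D × 2 * R + 3 * ω < 3 * D
      room = *-cancelˡ-< 4 _ _ (begin-strict
               4 * (R + 2 * ω)          ≡⟨ eq₁ R ω ⟩
               4 * R + 6 * ω + 2 * ω    <⟨ +-mono-< 4R+6ω<6D (*-monoʳ-< 2 ω<D) ⟩
               6 * D + 2 * D            ≡⟨ eq₂ D ⟩
               4 * (2 * D)              ∎)
           , *-cancelˡ-< 2 _ _ (begin-strict
               2 * (2 * R + 3 * ω)      ≡⟨ eq₃ R ω ⟩
               4 * R + 6 * ω            <⟨ 4R+6ω<6D ⟩
               6 * D                    ≡⟨ eq₄ D ⟩
               2 * (3 * D)              ∎)
        where
        open ≤-Reasoning
        eq₁ : ∀ R ω → 4 * (R + 2 * ω) ≡ 4 * R + 6 * ω + 2 * ω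
        eq₁ = solve-∀
        eq₂ : ∀ D → 6 * D + 2 * D ≡ 4 * (2 * D)
        eq₂ = solve-∀
        eq₃ : ∀ R ω → 2 * (2 * R + 3 * ω) ≡ 4 * R + 6 * ω
        eq₃ = solve-∀
        eq₄ : ∀ D → 6 * D ≡ 2 * (3 * D)
        eq₄ = solve-∀

edge-tuple : ∀ {k n} (H : Hypergraph k n) {e} → T (edge H e) → ∃ λ (f : Fin k → Fin n) → Edge H f
edge-tuple {k} {n} H {e} Ee = subst (λ m → ∃ λ (f : Fin m → Fin n) → Edge H f) (uniform H Ee)
  (let f , _ , eq = enumerate e in f , subst (T ∘ edge H) (sym eq) Ee)

module _ {K n} {a b c : Fin (suc K)} (a≢b : a ≢ b) (a≢c : a ≢ c) (b≢c : b ≢ c) (H : Hypergraph (suc K) n)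
         (F₁-free : ¬ Contains H (F₁ a b c)) (F₂-free : ¬ Contains H (F₂ a b c)) where

  private
    k η C ω : ℕ
    k = suc K
    -- With `η` linear in `n`, at most the constant number `3 * k * C` of vertices is heavy by
    -- `heavy-few`; the choice of `C` makes `slack K * k * η` at most `n`.
    C = suc (slack K * k)
    η = n / C
    ω = 3 * k * C + k * (3 * k + η)

    few : ∀ {h} → h * suc η ≤ n * (3 * k) → 0 < n → h ≤ 3 * k * C
    few {h} le 0<n = *-cancelʳ-≤ h (3 * k * C) n ⦃ >-nonZero 0<n ⦄ (begin
      h * n               ≤⟨ *-monoʳ-≤ h (<⇒≤ (n<[1+n/c]*c n (slack K * k))) ⟩
      h * (suc η * C)     ≡⟨ *-assoc h (suc η) C ⟨
      h * suc η * C       ≤⟨ *-monoˡ-≤ C le ⟩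
      n * (3 * k) * C     ≡⟨ eq n (3 * k) C ⟩
      3 * k * C * n       ∎)
      where
      open ≤-Reasoning
      eq : ∀ n x C → n * x * C ≡ x * C * n
      eq = solve-∀

    slackω≤4n : threshold K ≤ n → slack K * ω ≤ 4 * n
    slackω≤4n N≤n = begin
      slack K * ω
        ≡⟨ eq (slack K) (3 * k * C) k (3 * k) η ⟩
      slack K * (3 * k * C + k * (3 * k)) + slack K * k * η
        ≤⟨ +-mono-≤ (≤-trans (n≤1+n _) N≤n) (≤-trans (*-monoˡ-≤ η (n≤1+n (slack K * k)))
             (≤-trans (≤-reflexive (*-comm C η)) (m/n*n≤m n C))) ⟩
      n + n
        ≤⟨ +-monoʳ-≤ n (m≤m+n n (n + (n + 0))) ⟩
      4 * n ∎
      where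
      open ≤-Reasoning
      eq : ∀ s x k y η → s * (x + k * (y + η)) ≡ s * (x + k * y) + s * k * η
      eq = solve-∀

  -- Were the bound false, `δ⁺ H` could serve as `D` in `absurd`. As only a contradiction is sought,
  -- the doubly negated `robust⊎blocked` suffices.
  upper-bound : threshold K ≤ n → (1 + 4 * K) * δ⁺ H ≤ 4 * n
  upper-bound N≤n = ≮⇒≥ λ lt → robust⊎blocked a≢b a≢c b≢c H λ classify →
    let ω-bound = ω-small K n (δ⁺ H) lt (slackω≤4n N≤n)
        ω<δ     = ω<D K n (δ⁺ H) lt ω ω-bound
    in absurd a≢b a≢c b≢c H F₂-free F₁-free classify η (δ⁺≤degree H)
         (+-monoˡ-≤ (k * (3 * k + η)) (few (heavy-few a≢b a≢c b≢c H F₂-free F₁-free classify η) (≤-trans (s≤s z≤n) N≤n)))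
         ω<δ (n+kω<kD K n (δ⁺ H) lt ω ω-bound)
         (edge-tuple H (proj₂ (δ⁺>0⇒edge H (≤-<-trans z≤n ω<δ))))
         (λ {R} → room K n (δ⁺ H) lt ω ω-bound R)

-- Capped colourings

T-does : ∀ {P : Set} (P? : Dec P) → P → T (does P?)
T-does P? p = subst T (sym (dec-true P? p)) _

≔-injective : ∀ {m n} {f : Fin m → Fin n} {v} i → Inj f → (∀ l → l ≢ i → f l ≢ v) → Inj (f [ i ≔ v ])
≔-injective {f = f} {v} i inj avoid {x} {y} eq with x ≟ i | y ≟ i
... | yes refl | yes refl = refl
... | yes refl | no y≢i = contradiction (trans (sym (≔-miss f i y≢i)) (trans (sym eq) (≔-hit f i))) (avoid y y≢i)
... | no x≢i | yes refl = contradiction (trans (sym (≔-miss f i x≢i)) (trans eq (≔-hit f i))) (avoid x x≢i)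
... | no x≢i | no y≢i = inj (trans (sym (≔-miss f i x≢i)) (trans eq (≔-miss f i y≢i)))

module _ {k} {a b c : Fin k} where

  tuples₁-Inj : All Inj (tuples₁ a b c)
  tuples₁-Inj = base
              ∷ ≔-injective a base (λ _ _ ())
              ∷ ≔-injective b base (λ _ _ ())
              ∷ ≔-injective b base (λ _ _ ())
              ∷ ≔-injective a base (λ _ _ ())
              ∷ ≔-injective b (≔-injective a base (λ _ _ ())) second
              ∷ []
    where
    base : Inj (base₁ a b c)
    base = suc-injective ∘ suc-injective
    second : ∀ l → l ≢ b → (base₁ a b c [ a ≔ zero ]) l ≢ suc zero
    second l _ eq with l ≟ a
    ... | yes refl with () ← trans (sym (≔-hit (base₁ a b c) a)) eq
    ... | no l≢a   with () ← trans (sym (≔-miss (base₁ a b c) a l≢a)) eq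

  tuples₂-Inj : All Inj (tuples₂ a b c)
  tuples₂-Inj = All.++⁺ (All.tabulate⁺ {f = combine} inj)
    (All.++⁺ (All.tabulate⁺ {f = rerooted a b c a} (rerooted-inj a))
             (All.tabulate⁺ {f = rerooted a b c b} (rerooted-inj b)))
    where
    inj : ∀ (p : Fin 4) → Inj (combine {4} {k} p)
    inj p eq = combine-injectiveʳ p _ p _ eq
    rerooted-inj : ∀ i r → Inj (rerooted a b c i r)
    rerooted-inj i r = ≔-injective i (inj (suc r)) λ l _ eq →
      contradiction (combine-injectiveˡ (suc r) l zero (root a b c r) eq) λ ()

fibre-≔-≥ : ∀ {m n} (h : Fin m → Fin n) {a y} → h a ≢ y → fibre h y < fibre (h [ a ≔ y ]) y
fibre-≔-≥ {m} h {a} {y} ha≢y = begin-strict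
  fibre h y                                        <⟨ n<1+n _ ⟩
  1 + fibre h y                                    ≡⟨ cong (_+ fibre h y) (∑-⟦≡⟧ a) ⟨
  ∑[ l < m ] ⟦ a ≡ l ⟧ + fibre h y                 ≡⟨ ∑-distrib-+ (λ l → ⟦ a ≡ l ⟧) (λ l → ⟦ h l ≡ y ⟧) ⟨
  ∑[ l < m ] (⟦ a ≡ l ⟧ + ⟦ h l ≡ y ⟧)             ≤⟨ ∑-mono {m} pointwise ⟩
  fibre (h [ a ≔ y ]) y                            ∎
  where
  open ≤-Reasoning
  pointwise : ∀ l → ⟦ a ≡ l ⟧ + ⟦ h l ≡ y ⟧ ≤ ⟦ (h [ a ≔ y ]) l ≡ y ⟧
  pointwise l with a ≟ l
  ... | yes refl = ≤-reflexive (trans (cong suc (⟦≡⟧-no ha≢y)) (sym (⟦≡⟧-yes (≔-hit h a))))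
  ... | no a≢l   = ≤-reflexive (cong (λ v → ⟦ v ≡ y ⟧) (sym (≔-miss h a (a≢l ∘ sym))))

fibre-cong : ∀ {m n} {f g : Fin m → Fin n} → f ≗ g → ∀ v → fibre f v ≡ fibre g v
fibre-cong {m} f≗g v = sum-cong-≗ {m} λ i → cong (λ x → ⟦ x ≡ v ⟧) (f≗g i)

module Capped (k : ℕ) {t n} (cap : Fin t → ℕ) (colour : Fin n → Fin t) where

  colours : Subset n → Fin t → ℕ
  colours S i = ∑[ v < n ] (𝟙 (lookup S v) * ⟦ colour v ≡ i ⟧)

  Within? : (S : Subset n) → Dec (∀ i → colours S i ≤ cap i)
  Within? S = all? λ i → colours S i ≤? cap i

  capped : Hypergraph k n
  capped .edge e = does (Within? e) ∧ (∣ e ∣ ≡ᵇ k)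
  capped .uniform {e} t = ≡ᵇ⇒≡ ∣ e ∣ k (proj₂ (Equivalence.to T-∧ t))

  colours-set : ∀ {m} {g : Fin m → Fin n} → Inj g → ∀ i → colours (set g) i ≡ fibre (colour ∘ g) i
  colours-set {g = g} inj i = ∑-set g inj λ v → ⟦ colour v ≡ i ⟧

  colours-mono : ∀ {S S′} → S ⊆ S′ → ∀ i → colours S i ≤ colours S′ i
  colours-mono {S} {S′} S⊆ i = ∑-mono {n} λ v → *-monoˡ-≤ ⟦ colour v ≡ i ⟧ (by v)
    where
    by : ∀ v → 𝟙 (lookup S v) ≤ 𝟙 (lookup S′ v)
    by v with lookup S v in eq
    ... | false = z≤n
    ... | true rewrite []=⇒lookup (S⊆ (lookup⇒[]= v S eq)) = ≤-refl

  Proper : ∀ {m} → (Fin m → Fin n) → Set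
  Proper g = Inj g × (∀ i → fibre (colour ∘ g) i ≤ cap i)

  edge⇒within : ∀ {e} → T (edge capped e) → ∀ i → colours e i ≤ cap i
  edge⇒within {e} t = does-T (Within? e) (proj₁ (Equivalence.to (T-∧ {does (Within? e)}) t))

  Edge⇒Proper : {f : Fin k → Fin n} → Edge capped f → Proper f
  Edge⇒Proper {f} E = inj , λ i → ≤-trans (≤-reflexive (sym (colours-set inj i))) (edge⇒within {set f} E i)
    where
    inj : Inj f
    inj = Edge⇒Inj capped {f} E

  Proper⇒Edge : {f : Fin k → Fin n} → Proper f → Edge capped f
  Proper⇒Edge {f} (inj , within) = Equivalence.from T-∧
    ( T-does (Within? (set f)) (λ i → ≤-trans (≤-reflexive (colours-set inj i)) (within i))
    , ≡⇒≡ᵇ ∣ set f ∣ k (∣set∣ f inj))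

  module _ {a b c : Fin k} (a≢b : a ≢ b) where

    -- The colouring is injective on every edge, hence on all of F₁ by `tuples₁-injective`, although
    -- there are fewer than `2 + k` colours.
    F₁-free : (∀ i → cap i ≤ 1) → t < 2 + k → ¬ Contains capped (F₁ a b c)
    F₁-free cap≤1 t<2+k contains
      with φ , _ , Es ← contains⁻ (tuples₁ a b c) capped (tuples₁-Inj {a = a} {b} {c}) contains
      with x , y , x<y , eq ← pigeonhole t<2+k (colour ∘ φ)
      = <⇒≢ x<y (cong Fin.toℕ (tuples₁-injective a b c a≢b (colour ∘ φ)
          (All.map {Q = λ s → Inj (colour ∘ φ ∘ s)}
            (λ {s} E → fibre≤1⇒Inj (colour ∘ φ ∘ s) λ i → ≤-trans (proj₂ (Edge⇒Proper {φ ∘ s} E) i) (cap≤1 i)) Es) eq))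

    module _ (a≢c : a ≢ c) (b≢c : b ≢ c) (Σcap : sum cap ≡ k) (i₀ : Fin t)
             (cap₀ : cap i₀ ≤ 2) (unique : ∀ {i} → 1 < cap i → i ≡ i₀) where

      -- An edge has `k` vertices and the caps add up to `k`, so no cap has room left.
      saturated : {f : Fin k → Fin n} → Edge capped f → ∀ i → fibre (colour ∘ f) i ≡ cap i
      saturated {f} E = ∑-squeeze (proj₂ (Edge⇒Proper {f} E))
        (≤-reflexive (trans Σcap (sym (∑-fibre-1 (colour ∘ f)))))

      swap-colour : ∀ {f : Fin k → Fin n} {i v} → Edge capped f → Edge capped (f [ i ≔ v ]) → colour (f i) ≡ colour v
      swap-colour {f} {i} {v} E Ei with colour (f i) ≟ colour v
      ... | yes eq = eq
      ... | no neq = contradiction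
        (trans (saturated {f} E (colour v)) (trans (sym (saturated {f [ i ≔ v ]} Ei (colour v)))
          (fibre-cong (∘-≔ colour f i v) (colour v))))
        (<⇒≢ (fibre-≔-≥ (colour ∘ f) neq))

      -- By `swap-colour`, `v` shares its colour with both `f a` and `f b`, and only `i₀` can occur
      -- twice in an edge.
      double-colour : ∀ {f : Fin k → Fin n} {v} → Edge capped f → Edge capped (f [ a ≔ v ]) → Edge capped (f [ b ≔ v ]) →
                      colour v ≡ i₀
      double-colour {f} {v} E Ea Eb = unique (≤-trans
        (collision⇒fibre>1 (colour ∘ f) b≢a (trans fb (sym fa)))
        (≤-trans (proj₂ (Edge⇒Proper {f} E) _) (≤-reflexive (cong cap fb))))
        where
        b≢a : b ≢ a
        b≢a = a≢b ∘ sym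
        fa : colour (f a) ≡ colour v
        fa = swap-colour {f} E Ea
        fb : colour (f b) ≡ colour v
        fb = swap-colour {f} E Eb

      three-in-fibre : ∀ {m} (h : Fin k → Fin m) {v} → h a ≡ v → h b ≡ v → h c ≡ v → 2 < fibre h v
      three-in-fibre h {v} ha hb hc = begin-strict
        2
          <⟨ n<1+n 2 ⟩
        1 + (1 + 1)
          ≡⟨ cong₂ _+_ (∑-⟦≡⟧ a) (cong₂ _+_ (∑-⟦≡⟧ b) (∑-⟦≡⟧ c)) ⟨
        sum (λ l → ⟦ a ≡ l ⟧) + (sum (λ l → ⟦ b ≡ l ⟧) + sum (λ l → ⟦ c ≡ l ⟧))
          ≡⟨ cong (sum (λ l → ⟦ a ≡ l ⟧) +_) (∑-distrib-+ (λ l → ⟦ b ≡ l ⟧) (λ l → ⟦ c ≡ l ⟧)) ⟨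
        sum (λ l → ⟦ a ≡ l ⟧) + sum (λ l → ⟦ b ≡ l ⟧ + ⟦ c ≡ l ⟧)
          ≡⟨ ∑-distrib-+ (λ l → ⟦ a ≡ l ⟧) (λ l → ⟦ b ≡ l ⟧ + ⟦ c ≡ l ⟧) ⟨
        sum (λ l → ⟦ a ≡ l ⟧ + (⟦ b ≡ l ⟧ + ⟦ c ≡ l ⟧))
          ≤⟨ ∑-mono pointwise ⟩
        fibre h v ∎
        where
        open ≤-Reasoning
        pointwise : ∀ l → ⟦ a ≡ l ⟧ + (⟦ b ≡ l ⟧ + ⟦ c ≡ l ⟧) ≤ ⟦ h l ≡ v ⟧
        pointwise l with a ≟ l | b ≟ l | c ≟ l
        ... | yes refl | yes refl | _        = contradiction refl a≢b
        ... | yes refl | no _     | yes refl = contradiction refl a≢c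
        ... | yes refl | no _     | no _     = ≤-reflexive (sym (⟦≡⟧-yes ha))
        ... | no _     | yes refl | yes refl = contradiction refl b≢c
        ... | no _     | yes refl | no _     = ≤-reflexive (sym (⟦≡⟧-yes hb))
        ... | no _     | no _     | yes refl = ≤-reflexive (sym (⟦≡⟧-yes hc))
        ... | no _     | no _     | no _     = z≤n

      F₂-free : ¬ Contains capped (F₂ a b c)
      F₂-free contains
        with φ , _ , Es ← contains⁻ (tuples₂ a b c) capped (tuples₂-Inj {a = a} {b} {c}) contains
        = <⇒≱ (three-in-fibre (colour ∘ φ ∘ block a b c zero) (root₀ zero) (root₀ (suc zero)) (root₀ (suc (suc zero))))
            (≤-trans (proj₂ (Edge⇒Proper {φ ∘ block a b c zero} (blocks zero)) i₀) cap₀)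
        where
        parts : All (λ s → Edge capped (φ ∘ s)) (tabulate (block a b c))
              × All (λ s → Edge capped (φ ∘ s)) (tabulate (rerooted a b c a) ++ tabulate (rerooted a b c b))
        parts = All.++⁻ (tabulate (block a b c)) Es
        blocks : ∀ p → Edge capped (φ ∘ block a b c p)
        blocks = All.tabulate⁻ (proj₁ parts)
        rerooted-a : ∀ r → Edge capped (φ ∘ rerooted a b c a r)
        rerooted-a = All.tabulate⁻ (proj₁ (All.++⁻ (tabulate (rerooted a b c a)) (proj₂ parts)))
        rerooted-b : ∀ r → Edge capped (φ ∘ rerooted a b c b r)
        rerooted-b = All.tabulate⁻ (proj₂ (All.++⁻ (tabulate (rerooted a b c a)) (proj₂ parts)))
        root₀ : ∀ r → colour (φ (block a b c zero (root a b c r))) ≡ i₀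
        root₀ r = double-colour {φ ∘ block a b c (suc r)} (blocks (suc r))
          (Edge-cong capped {f = φ ∘ rerooted a b c a r} (∘-≔ φ (block a b c (suc r)) a _) (rerooted-a r))
          (Edge-cong capped {f = φ ∘ rerooted a b c b r} (∘-≔ φ (block a b c (suc r)) b _) (rerooted-b r))

-- Codegrees of capped hypergraphs

module _ {K t n : ℕ} (cap : Fin t → ℕ) (colour : Fin n → Fin t) where

  open Capped (suc K) cap colour

  vacancy : ∀ {m} → (Fin m → Fin n) → Fin t → ℕ
  vacancy g i = 𝟙 (does (fibre (colour ∘ g) i <? cap i))

  -- A vacancy is at most 1, so the one strict inequality says both that `d` is new and that its
  -- colour is still open.
  extend-proper : ∀ {m} {g : Fin m → Fin n} {d} → Proper g → fibre g d < vacancy g (colour d) → Proper (d ◂ g)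
  extend-proper {m} {g} {d} (inj , within) lt = inj′ , within′
    where
    ∉g : ∀ l → g l ≢ d
    ∉g l gl≡d = <⇒≱ (<-≤-trans lt (𝟙≤1 _)) (≤-trans (≤-reflexive (sym (⟦≡⟧-yes gl≡d))) (≤-∑ (λ l → ⟦ g l ≡ d ⟧) l))
    has-vacancy : fibre (colour ∘ g) (colour d) < cap (colour d)
    has-vacancy = does-T (fibre (colour ∘ g) (colour d) <? cap (colour d)) (𝟙-true (≤-<-trans z≤n lt))
    inj′ : Inj (d ◂ g)
    inj′ {zero}  {zero}  _  = refl
    inj′ {zero}  {suc y} eq = contradiction (sym eq) (∉g y)
    inj′ {suc x} {zero}  eq = contradiction eq (∉g x)
    inj′ {suc x} {suc y} eq = cong suc (inj eq)
    within′ : ∀ i → fibre (colour ∘ (d ◂ g)) i ≤ cap i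
    within′ i with colour d ≟ i
    ... | yes refl = has-vacancy
    ... | no _     = within i

  -- `ρ` is the number of colours sure to stay open for up to `K` vertices, and `L` bounds the class
  -- sizes from below. In `plenty`, `s` open colours with caps at most `M`, plus `K` vertices,
  -- account for the sum of all caps.
  module _ (ρ L M : ℕ) (cap≤M : ∀ i → cap i ≤ M) (large : ∀ i → L ≤ fibre colour i)
           (plenty : ∀ s → sum cap ≤ M * s + K → ρ ≤ s) where

    vacancy-count : ∀ {m} (g : Fin m → Fin n) → m ≤ K → ρ * L ≤ ∑[ d < n ] vacancy g (colour d)
    vacancy-count {m} g m≤K = begin
      ρ * L                                        ≤⟨ *-monoˡ-≤ L (plenty (sum (vacancy g)) many) ⟩
      sum (vacancy g) * L                             ≡⟨ *-distribʳ-sum L (vacancy g) ⟩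
      ∑[ i < t ] (vacancy g i * L)                    ≤⟨ ∑-mono {t} (λ i → ≤-trans (*-monoʳ-≤ (vacancy g i) (large i))
                                                        (≤-reflexive (*-comm (vacancy g i) (fibre colour i)))) ⟩
      ∑[ i < t ] (fibre colour i * vacancy g i)       ≡⟨ ∑-fibre colour (vacancy g) ⟩
      ∑[ d < n ] vacancy g (colour d)                 ∎
      where
      open ≤-Reasoning
      cap≤ : ∀ i → cap i ≤ M * vacancy g i + fibre (colour ∘ g) i
      cap≤ i = by (fibre (colour ∘ g) i <? cap i)
        where
        by : (vacancy? : Dec (fibre (colour ∘ g) i < cap i)) → cap i ≤ M * 𝟙 (does vacancy?) + fibre (colour ∘ g) i
        by (yes _)   = ≤-trans (cap≤M i) (≤-trans (≤-reflexive (sym (*-identityʳ M))) (m≤m+n (M * 1) _))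
        by (no full) = ≤-trans (≮⇒≥ full) (m≤n+m _ (M * 0))
      many : sum cap ≤ M * sum (vacancy g) + K
      many = begin
        sum cap                                                      ≤⟨ ∑-mono cap≤ ⟩
        ∑[ i < t ] (M * vacancy g i + fibre (colour ∘ g) i)             ≡⟨ ∑-distrib-+ (λ i → M * vacancy g i) (fibre (colour ∘ g)) ⟩
        ∑[ i < t ] (M * vacancy g i) + ∑[ i < t ] fibre (colour ∘ g) i  ≡⟨ cong₂ _+_ (sym (*-distribˡ-sum M (vacancy g))) (∑-fibre-1 (colour ∘ g)) ⟩
        M * sum (vacancy g) + m                                         ≤⟨ +-monoʳ-≤ _ m≤K ⟩
        M * sum (vacancy g) + K                                         ∎

    proper-tuple : K < ρ * L → ∀ m → m ≤ suc K → ∃ λ (g : Fin m → Fin n) → Proper g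
    proper-tuple K<ρL zero    _         = (λ ()) , (λ { {()} }) , λ _ → z≤n
    proper-tuple K<ρL (suc m) (s≤s m≤K) with g , proper ← proper-tuple K<ρL m (m≤n⇒m≤1+n m≤K)
      with d , lt ← ∑<∑⇒∃< (fibre g) (λ d → vacancy g (colour d))
             (<-≤-trans (≤-<-trans (≤-trans (≤-reflexive (∑-fibre-1 g)) m≤K) K<ρL) (vacancy-count g m≤K))
      = d ◂ g , extend-proper proper lt

    codegree-≥ : ∀ {g : Fin K → Fin n} → Proper g → ρ * L ≤ codegree capped (set g) + K
    codegree-≥ {g} proper = begin
      ρ * L
        ≤⟨ vacancy-count g ≤-refl ⟩
      ∑[ d < n ] vacancy g (colour d)
        ≤⟨ ∑-mono vacancy≤ ⟩
      ∑[ d < n ] (𝟙 (edge capped (set (d ◂ g))) + fibre g d)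
        ≡⟨ ∑-distrib-+ (λ d → 𝟙 (edge capped (set (d ◂ g)))) (fibre g) ⟩
      ∑[ d < n ] 𝟙 (edge capped (set (d ◂ g))) + ∑[ d < n ] fibre g d
        ≡⟨ cong₂ _+_ (sym (codegree-set capped (proj₁ proper))) (∑-fibre-1 g) ⟩
      codegree capped (set g) + K ∎
      where
      open ≤-Reasoning
      vacancy≤ : ∀ d → vacancy g (colour d) ≤ 𝟙 (edge capped (set (d ◂ g))) + fibre g d
      vacancy≤ d with fibre g d <? vacancy g (colour d)
      ... | yes lt = ≤-trans (𝟙≤1 _) (≤-trans
                       (≤-reflexive (sym (T⇒𝟙≡1 (Proper⇒Edge {d ◂ g} (extend-proper proper lt)))))
                       (m≤m+n _ (fibre g d)))
      ... | no nlt = ≤-trans (≮⇒≥ nlt) (m≤n+m _ _)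

    shadow⇒proper : ∀ {S} → S ∈ˡ shadow capped → ∃ λ (g : Fin K → Fin n) → Proper g × set g ≡ S
    shadow⇒proper {S} S∈ with ∣S∣ , e , Ee , S⊆e ← shadow⁻ capped S∈
      = subst (λ m → ∃ λ (g : Fin m → Fin n) → Proper g × set g ≡ S) ∣S∣
          (let g , inj , eq = enumerate S in g
             , (inj , λ i → ≤-trans (≤-reflexive (sym (colours-set inj i)))
                 (≤-trans (≤-reflexive (cong (λ S → colours S i) eq))
                   (≤-trans (colours-mono S⊆e i) (edge⇒within {e} Ee i))))
             , eq)

    -- Without edges `δ⁺` takes the default value 0, so an edge has to be built first. If `ρ * L` is
    -- too small for the greedy construction, the bound is trivial.
    ρL≤δ⁺+K : ρ * L ≤ δ⁺ capped + K
    ρL≤δ⁺+K with K <? ρ * L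
    ... | no  K≮ρL = ≤-trans (≮⇒≥ K≮ρL) (m≤n+m K (δ⁺ capped))
    ... | yes K<ρL with f , proper ← proper-tuple K<ρL (suc K) ≤-refl
      = m∸n≤o⇒m≤o+n (≤δ⁺ capped
          (shadow⁺ capped {e = set f} (∣set∣ (tail f) (suc-injective ∘ proj₁ proper)) (Proper⇒Edge {f} proper)
            (set-⊆ {f = tail f} {f} λ i → suc i , refl))
          λ S∈ → codegree-bound (shadow⇒proper S∈))
      where
      m∸n≤o⇒m≤o+n : ∀ {m n o} → m ∸ n ≤ o → m ≤ o + n
      m∸n≤o⇒m≤o+n {m} {n} {o} le = ≤-trans (m≤n+m∸n m n) (≤-trans (+-monoʳ-≤ n le) (≤-reflexive (+-comm n o)))
      codegree-bound : ∀ {S} → (∃ λ (g : Fin K → Fin n) → Proper g × set g ≡ S) → ρ * L ∸ K ≤ codegree capped S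
      codegree-bound (g , proper , refl) = m≤n+o⇒m∸n≤o (ρ * L) K (≤-trans (codegree-≥ proper) (≤-reflexive (+-comm _ K)))

fibre-++ : ∀ {m m′ n} (f : Fin m → Fin n) (g : Fin m′ → Fin n) v → fibre (f ++ᶠ g) v ≡ fibre f v + fibre g v
fibre-++ {zero}  f g v = refl
fibre-++ {suc m} {m′} f g v = trans (cong (⟦ f zero ≡ v ⟧ +_)
    (trans (fibre-cong {f = (f ++ᶠ g) ∘ suc} {tail f ++ᶠ g} (λ i → [,]-map (splitAt m i)) v) (fibre-++ (tail f) g v)))
  (sym (+-assoc ⟦ f zero ≡ v ⟧ (fibre (tail f) v) (fibre g v)))

-- Each round splits off `suc t` vertices and gives them one colour each.
balanced : ∀ {t} L n → L * suc t ≤ n → ∃ λ (colour : Fin n → Fin (suc t)) → ∀ i → L ≤ fibre colour i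
balanced zero    n _ = const zero , λ _ → z≤n
balanced {t} (suc L) n le with m , refl ← m≤n⇒∃[o]m+o≡n (≤-trans (m≤m+n (suc t) (L * suc t)) le)
  with colour , large ← balanced {t} L m (+-cancelˡ-≤ (suc t) (L * suc t) m le)
  = id ++ᶠ colour , λ i → ≤-trans
      (+-mono-≤ (≤-trans (≤-reflexive (sym (⟦≡⟧-yes {x = i} refl))) (≤-∑ (λ l → ⟦ l ≡ i ⟧) i)) (large i))
      (≤-reflexive (sym (fibre-++ id colour i)))

-- Densities

infix 5 _/1+_
_/1+_ : ℕ → ℕ → ℚᵘ
m /1+ d = ℤ.+ m ℚᵘ./ suc d

/1+-mono-≤ : ∀ {p b c d} → p * suc d ≤ c * suc b → p /1+ b ℚᵘ.≤ c /1+ d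
/1+-mono-≤ {p} {b} {c} {d} le = *≤* (subst₂ ℤ._≤_ (ℤ.pos-* p (suc d)) (ℤ.pos-* c (suc b)) (ℤ.+≤+ le))

/1+-mono-< : ∀ {p b c d} → p * suc d < c * suc b → p /1+ b ℚᵘ.< c /1+ d
/1+-mono-< {p} {b} {c} {d} lt = *<* (subst₂ ℤ._<_ (ℤ.pos-* p (suc d)) (ℤ.pos-* c (suc b)) (ℤ.+<+ lt))

-- The fractions m / (1 + m R) increase to 1 / R.
mediant-< : ∀ m R → suc m /1+ suc m * R ℚᵘ.< suc (suc m) /1+ suc (suc m) * R
mediant-< m R = /1+-mono-< (≤-reflexive (eq m R))
  where
  eq : ∀ m R → suc ((1 + m) * (1 + (2 + m) * R)) ≡ (2 + m) * (1 + (1 + m) * R)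
  eq = solve-∀

module _ {k} (𝓕 : Family k) where

  -- Expresses a density of at least `1 / R` without division, with an additive error `c`.
  Growth : ℕ → ℕ → Set
  Growth R c = ∀ n → ∃ λ (H : Hypergraph k n) → Free 𝓕 H × n ≤ R * δ⁺ H + c

  growth⇒lower : ∀ R c → Growth R c → ∀ m → Eventually λ n → m /1+ m * R ℚᵘ.≤ ratio 𝓕 n
  -- From this threshold on, `m * c ≤ ex⁺ 𝓕 n`, which absorbs the error.
  growth⇒lower R c growth m = suc (R * (m * c) + c) , bound
    where
    open ≤-Reasoning
    n≤ : ∀ n → n ≤ R * ex⁺ 𝓕 n + c
    n≤ n with H , free , le ← growth n = ≤-trans le (+-monoˡ-≤ c (*-monoʳ-≤ R (δ⁺≤ex⁺ 𝓕 H free)))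
    bound : ∀ n → n ≥ suc (R * (m * c) + c) → m /1+ m * R ℚᵘ.≤ ratio 𝓕 n
    bound n@(suc n′) N≤n = /1+-mono-≤ (begin
      m * n                        ≤⟨ *-monoʳ-≤ m (n≤ n) ⟩
      m * (R * ex⁺ 𝓕 n + c)        ≡⟨ eq m R (ex⁺ 𝓕 n) c ⟩
      m * c + ex⁺ 𝓕 n * (m * R)    ≤⟨ +-monoˡ-≤ _ mc≤ex ⟩
      ex⁺ 𝓕 n + ex⁺ 𝓕 n * (m * R)  ≡⟨ *-suc (ex⁺ 𝓕 n) (m * R) ⟨
      ex⁺ 𝓕 n * suc (m * R)        ∎)
      where
      eq : ∀ m R e c → m * (R * e + c) ≡ m * c + e * (m * R)
      eq = solve-∀
      mc≤ex : m * c ≤ ex⁺ 𝓕 n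
      mc≤ex = ≮⇒≥ λ ex<mc → <⇒≱ N≤n (≤-trans (n≤ n) (+-monoˡ-≤ c (*-monoʳ-≤ R (<⇒≤ ex<mc))))

  bounded⇒upper : ∀ {p b N} → (∀ n (H : Hypergraph k n) → n ≥ N → Free 𝓕 H → suc b * δ⁺ H ≤ p * n) →
                  (∀ n → ∃ λ (H : Hypergraph k n) → Free 𝓕 H) → Eventually λ n → ratio 𝓕 n ℚᵘ.≤ p /1+ b
  -- The maximum with 1 avoids `n = 0`, where `ratio` is set by convention.
  bounded⇒upper {p} {b} {N} bounded free = N ⊔ 1 , bound
    where
    bound : ∀ n → n ≥ N ⊔ 1 → ratio 𝓕 n ℚᵘ.≤ p /1+ b
    bound zero le = contradiction (≤-trans (m≤n⊔m N 1) le) λ ()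
    bound n@(suc _) le with H , H-free ← free n with G , G-free , δ≡ex ← ex⁺-attained 𝓕 H H-free
      = /1+-mono-≤ (≤-trans (≤-reflexive (trans (*-comm _ (suc b)) (cong (suc b *_) (sym δ≡ex))))
          (bounded n G (≤-trans (m≤m⊔n N 1) le) G-free))

capped-growth : ∀ {K t} (𝓕 : Family (suc K)) (cap : Fin (suc t) → ℕ) (ρ M R : ℕ) →
                (∀ i → cap i ≤ M) → (∀ s → sum cap ≤ M * s + K → ρ ≤ s) → suc t ≤ R * ρ →
                (∀ {n} (colour : Fin n → Fin (suc t)) → Free 𝓕 (Capped.capped (suc K) cap colour)) →
                Growth 𝓕 R (R * K + suc t)
capped-growth {K} {t} 𝓕 cap ρ M R cap≤M plenty t≤Rρ free n
  with colour , large ← balanced {t} (n / suc t) n (m/n*n≤m n (suc t))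
  = Capped.capped (suc K) cap colour , free colour , (begin
    n                                          ≤⟨ <⇒≤ (n<[1+n/c]*c n t) ⟩
    suc t + L * suc t                          ≤⟨ +-monoʳ-≤ (suc t) (*-monoʳ-≤ L t≤Rρ) ⟩
    suc t + L * (R * ρ)                        ≡⟨ eq₁ (suc t) L R ρ ⟩
    R * (ρ * L) + suc t                        ≤⟨ +-monoˡ-≤ (suc t) (*-monoʳ-≤ R (ρL≤δ⁺+K cap colour ρ L M cap≤M large plenty)) ⟩
    R * (δ⁺ (Capped.capped (suc K) cap colour) + K) + suc t  ≡⟨ eq₂ R _ K (suc t) ⟩
    R * δ⁺ (Capped.capped (suc K) cap colour) + (R * K + suc t) ∎)
  where
  open ≤-Reasoning
  L : ℕ
  L = n / suc t
  eq₁ : ∀ t L R ρ → t + L * (R * ρ) ≡ R * (ρ * L) + t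
  eq₁ = solve-∀
  eq₂ : ∀ R d K t → R * (d + K) + t ≡ R * d + (R * K + t)
  eq₂ = solve-∀

-- The densities of F₁, F₂ and the pair

module _ (k₀ : ℕ) where

  private
    K k : ℕ
    K = 2 + k₀
    k = suc K

    a b c : Fin k
    a = zero
    b = suc zero
    c = suc (suc zero)

    a≢b : a ≢ b
    a≢b ()
    a≢c : a ≢ c
    a≢c ()
    b≢c : b ≢ c
    b≢c ()

  G₁ G₂ : Graph k
  G₁ = 2 + k , F₁ a b c
  G₂ = 4 * k , F₂ a b c

  sum-1 : ∀ t → sum {t} (const 1) ≡ t
  sum-1 t = trans (∑-const t 1) (*-identityʳ t)

  growth₁ : Growth (G₁ ∷ []) K (K * K + (2 + K))
  growth₁ = capped-growth (G₁ ∷ []) (const 1) 2 1 K (λ _ → ≤-refl)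
    (λ s le → +-cancelʳ-≤ K 2 s (≤-trans (≤-reflexive (sym (sum-1 (2 + K))))
      (≤-trans le (≤-reflexive (cong (_+ K) (*-identityˡ s))))))
    -- `2 + K ≤ 2 * K`, which holds because `K ≥ 2`.
    (≤-trans (+-monoʳ-≤ 4 (m≤m+n k₀ k₀)) (≤-reflexive (eq k₀)))
    λ colour → Capped.F₁-free k (const 1) colour {a} {b} {c} a≢b (λ _ → ≤-refl) ≤-refl ∷ []
    where
    eq : ∀ k₀ → 4 + (k₀ + k₀) ≡ (2 + k₀) * 2
    eq = solve-∀

  growth₂ : Growth (G₂ ∷ []) K (K * K + K)
  growth₂ = capped-growth (G₂ ∷ []) cap 1 2 K cap≤2
    -- The caps add up to `K + 1`, so `K` vertices cannot fill all of them.
    (λ { zero le → contradiction (≤-trans (≤-reflexive (sym Σcap)) le) (<⇒≱ ≤-refl) ; (suc s) _ → s≤s z≤n })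
    (≤-reflexive (sym (*-identityʳ K)))
    λ colour → Capped.F₂-free k cap colour {a} {b} {c} a≢b a≢c b≢c Σcap zero ≤-refl unique ∷ []
    where
    cap : Fin K → ℕ
    cap = 2 ◂ const 1
    Σcap : sum cap ≡ k
    Σcap = cong (λ s → 2 + s) (sum-1 (suc k₀))
    cap≤2 : ∀ i → cap i ≤ 2
    cap≤2 zero    = ≤-refl
    cap≤2 (suc _) = s≤s z≤n
    unique : ∀ {i} → 1 < cap i → i ≡ zero
    unique {zero}  _ = refl
    unique {suc _} (s≤s ())

  growth₁₂ : Growth (G₁ ∷ G₂ ∷ []) k (k * K + k)
  growth₁₂ = capped-growth (G₁ ∷ G₂ ∷ []) (const 1) 1 1 k (λ _ → ≤-refl)
    (λ { zero le → contradiction (≤-trans (≤-reflexive (sym (sum-1 k))) le) (<⇒≱ ≤-refl) ; (suc s) _ → s≤s z≤n })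
    (≤-reflexive (sym (*-identityʳ k)))
    λ colour → Capped.F₁-free k (const 1) colour {a} {b} {c} a≢b (λ _ → ≤-refl) (n≤1+n _)
             ∷ Capped.F₂-free k (const 1) colour {a} {b} {c} a≢b a≢c b≢c (sum-1 k) zero
                 (s≤s z≤n) (λ { (s≤s ()) }) ∷ []

  upper₁₂ : Eventually λ n → ratio (G₁ ∷ G₂ ∷ []) n ℚᵘ.≤ 4 /1+ 4 * K
  upper₁₂ = bounded⇒upper (G₁ ∷ G₂ ∷ [])
    (λ n H N≤n → λ { (F₁-free ∷ F₂-free ∷ []) → upper-bound a≢b a≢c b≢c H F₁-free F₂-free N≤n })
    λ n → let H , free , _ = growth₁₂ n in H , free

theorem1 : ∀ (k : ℕ) → k ≥ 3 →
    ∃ λ (F₁ : Graph k) → ∃ λ (F₂ : Graph k) →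
    (fromℚᵘ 0ℚᵘ <ᶜ γ⁺ (F₁ ∷ F₂ ∷ [])) ×
    (γ⁺ (F₁ ∷ F₂ ∷ []) <ᶜ γ⁺ (F₁ ∷ []) ⊓ᶜ γ⁺ (F₂ ∷ []))
theorem1 (suc (suc (suc k₀))) (s≤s (s≤s (s≤s z≤n))) = G₁ k₀ , G₂ k₀
  -- `lim` demands a gap beside the separating rational, hence the consecutive fractions
  -- `m / (1 + m R)`: for `R = k` the separator `m = 1` below the lower bound `m = 2`, and for
  -- `R = k - 1` the upper bound `m = 4`, the separator 5 and the lower bounds 6.
  , (1 /1+ 1 * (3 + k₀) , /1+-mono-< {0} {0} {1} z<s
    , 2 /1+ 2 * (3 + k₀) , mediant-< 0 (3 + k₀)
    , growth⇒lower (G₁ k₀ ∷ G₂ k₀ ∷ []) (3 + k₀) _ (growth₁₂ k₀) 2)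
  , (5 /1+ 5 * (2 + k₀)
    , (4 /1+ 4 * (2 + k₀) , mediant-< 3 (2 + k₀) , upper₁₂ k₀)
    , (6 /1+ 6 * (2 + k₀) , mediant-< 4 (2 + k₀) , growth⇒lower (G₁ k₀ ∷ []) (2 + k₀) _ (growth₁ k₀) 6)
    , (6 /1+ 6 * (2 + k₀) , mediant-< 4 (2 + k₀) , growth⇒lower (G₂ k₀ ∷ []) (2 + k₀) _ (growth₂ k₀) 6))
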